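{- Let $p$ be a prime number. If $B(x)\in\overline{\mathbb{Q}}[x]$ is a Belyi polynomial of degree less than $p$ with $B(0)=0$, then $\operatorname{New}_p(B(x)-1)$ is a line segment.
   Context: Fix a prime $p$, an algebraic closure $\overline{\mathbb{Q}}_p$ of the field $\mathbb{Q}_p$ of $p$-adic numbers, and an algebraic closure $\overline{\mathbb{Q}}$ of $\mathbb{Q}$ embedded in $\overline{\mathbb{Q}}_p$. Let $\nu_p:\overline{\mathbb{Q}}_p\to\mathbb{R}\cup\{\infty\}$ be the $p$-adic valuation, i.e. the extension to $\overline{\mathbb{Q}}_p$ of the usual $p$-adic valuation on $\mathbb{Q}$ (with $\nu_p(p)=1$ and $\nu_p(0)=\infty$). A (normalized) Belyi polynomial is a nonconstant polynomial $B(x)\in\overline{\mathbb{Q}}[x]$ such that $B(0),B(1)\in\{0,1\}$ and $\{B(x_i): B'(x_i)=0\}\subset\{0,1\}$. For a nonzero polynomial $f(x)=a_0+a_1x+\cdots+a_nx^n$ over $\overline{\mathbb{Q}}$, $\operatorname{Conv}_p(f)$ denotes the convex hull in $\mathbb{R}^2$ of the points $(i,\nu_p(a_i))$ with $a_i\neq 0$. The Newton polygon $\operatorname{New}_p(f(x))$ is the lower boundary of $\operatorname{Conv}_p(f)$: it is $\operatorname{Conv}_p(f)$ itself if that set is a point or a line segment; if $\operatorname{Conv}_p(f)$ is a polygon, it is the union of the segments $[v_0,v_1]\cup\cdots\cup[v_{m-1},v_m]$ joining consecutive vertices of the polygon, listed counter-clockwise from the left-most vertex $v_0$ to the right-most vertex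 $v_m$.
   Formalization: The p-adic valuation takes values in the rationals instead of the reals, and the convex hull, Newton polygon and line segment are sets of points with rational coordinates instead of subsets of the real plane. -}

module Defs where

open import Level using (Level; 0ℓ; _⊔_) renaming (suc to lsuc)
open import Algebra.Apartness.Bundles using (HeytingField; HeytingCommutativeRing)
open import Algebra.Bundles using (CommutativeRing)
open import Algebra.Bundles.Raw using (RawRing)
open import Algebra.Morphism.Structures using (module RingMorphisms)
open RingMorphisms using (IsRingHomomorphism)
import Algebra.Definitions.RawMonoid as RawMonoidDefs
open import Data.Integer.Base as ℤ using (+_)
open import Data.List.Base using (List; []; _∷_; map; foldr; head; last)
open import Data.List.Relation.Unary.All using (All)
open import Data.List.Relation.Unary.Linked using (Linked)
open import Data.List.Relation.Unary.Unique.Propositional using (Unique)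
open import Data.Maybe.Relation.Unary.Any using () renaming (Any to AnyMaybe)
open import Data.Nat.Base as ℕ using (ℕ; zero; suc)
open import Data.Nat.Divisibility using (_∣_; _∤_)
open import Data.Product.Base using (Σ-syntax; ∃-syntax; _×_; _,_; proj₁; proj₂)
open import Data.Rational.Base as ℚ using (ℚ; 0ℚ; 1ℚ; ↥_; ↧ₙ_)
open import Data.Rational.Properties using () renaming (heytingField to ℚ-field)
open import Data.Sum.Base using (_⊎_)
open import Relation.Binary.PropositionalEquality.Core using (_≡_; _≢_)
open import Relation.Nullary.Negation.Core using (¬_)
open import Relation.Unary using (Pred; _≐_; ｛_｝)

private
  variable
    a b c a′ b′ c′ ℓ : Level

rawRing : HeytingField a b c → RawRing a b
rawRing K = CommutativeRing.rawRing
  (HeytingCommutativeRing.commutativeRing (HeytingField.heytingCommutativeRing K))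

-- A Heyting field is a field in the usual sense: classically _#_ is the
-- negation of _≈_, while constructively this reading also admits ℚₚ, whose
-- equality is not decidable.  Ring homomorphisms between fields are injective,
-- so injectivity need not be required.
record Embedding (K : HeytingField a b c) (L : HeytingField a′ b′ c′)
                 : Set (a ⊔ b ⊔ a′ ⊔ b′) where
  field
    ⟦_⟧                : HeytingField.Carrier K → HeytingField.Carrier L
    isRingHomomorphism : IsRingHomomorphism (rawRing K) (rawRing L) ⟦_⟧

open Embedding using (⟦_⟧)

-- The list a₀ ∷ a₁ ∷ … ∷ aₙ ∷ [] stands for a₀ + a₁x + ⋯ + aₙxⁿ.
-- Trailing zeros are allowed, so the length does not determine the degree.

module Polynomial {a b c : Level} (K : HeytingField a b c) where
  open HeytingField K
  open RawMonoidDefs (RawRing.+-rawMonoid (rawRing K)) using () renaming (_×_ to _·_)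

  Poly : Set a
  Poly = List Carrier

  coeff : Poly → ℕ → Carrier
  coeff []      _       = 0#
  coeff (k ∷ _) zero    = k
  coeff (_ ∷ f) (suc i) = coeff f i

  eval : Poly → Carrier → Carrier
  eval f x = foldr (λ k r → k + x * r) 0# f

  infixl 6 _+ᵖ_
  _+ᵖ_ : Poly → Poly → Poly
  []      +ᵖ g       = g
  (k ∷ f) +ᵖ []      = k ∷ f
  (k ∷ f) +ᵖ (l ∷ g) = (k + l) ∷ (f +ᵖ g)

  const : Carrier → Poly
  const k = k ∷ []

  derivative : Poly → Poly
  derivative []      = []
  derivative (_ ∷ f) = scaleFrom 1 f
    where
    scaleFrom : ℕ → Poly → Poly
    scaleFrom _ []      = []
    scaleFrom i (k ∷ g) = (i · k) ∷ scaleFrom (suc i) g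

  HasDegree : Poly → ℕ → Set (b ⊔ c)
  HasDegree f n = coeff f n # 0# × (∀ i → n ℕ.< i → coeff f i ≈ 0#)

  IsRoot : Poly → Carrier → Set b
  IsRoot f x = eval f x ≈ 0#

  IsZeroOrOne : Carrier → Set b
  IsZeroOrOne x = x ≈ 0# ⊎ x ≈ 1#

  record IsBelyi (f : Poly) : Set (a ⊔ b ⊔ c) where
    field
      nonconstant    : ∃[ i ] coeff f (suc i) # 0#
      value-at-0     : IsZeroOrOne (eval f 0#)
      value-at-1     : IsZeroOrOne (eval f 1#)
      criticalValues : ∀ x → IsRoot (derivative f) x → IsZeroOrOne (eval f x)

open Polynomial

mapPoly : {K : HeytingField a b c} {L : HeytingField a′ b′ c′} →
          Embedding K L → Poly K → Poly L
mapPoly ι = map ⟦ ι ⟧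

record IsAlgebraicClosure {K : HeytingField a b c} {L : HeytingField a′ b′ c′}
                          (ι : Embedding K L) : Set (a ⊔ b ⊔ c ⊔ a′ ⊔ b′ ⊔ c′) where
  field
    algebraic : ∀ x → ∃[ f ] ∃[ n ] (HasDegree K f n × IsRoot L (mapPoly ι f) x)
    closed    : ∀ f n → HasDegree L f (suc n) → ∃[ x ] IsRoot L f x

-- A valuation is given on the nonzero elements only, its value at 0 being ∞.
-- Since ℚ contains the value group of the algebraic closure of ℚₚ, rational
-- values suffice.

record Valuation (K : HeytingField a b c) : Set (a ⊔ b ⊔ c) where
  open HeytingField K
  field
    ν      : ∀ x → x # 0# → ℚ
    ν-cong : ∀ {x y} (x#0 : x # 0#) (y#0 : y # 0#) → x ≈ y → ν x x#0 ≡ ν y y#0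
    ν-*    : ∀ {x y} (x#0 : x # 0#) (y#0 : y # 0#) (xy#0 : x * y # 0#) →
             ν (x * y) xy#0 ≡ ν x x#0 ℚ.+ ν y y#0
    ν-+    : ∀ {x y} (x#0 : x # 0#) (y#0 : y # 0#) (x+y#0 : x + y # 0#) →
             ν x x#0 ℚ.⊓ ν y y#0 ℚ.≤ ν (x + y) x+y#0

  -- ν (x - y) ≥ N, where ν 0 = ∞.
  Close : ℚ → Carrier → Carrier → Set c
  Close N x y = (x-y#0 : x - y # 0#) → N ℚ.≤ ν (x - y) x-y#0

open Valuation using (ν; Close)

Extends : {K : HeytingField a b c} {L : HeytingField a′ b′ c′} →
          Embedding K L → Valuation K → Valuation L → Set (a ⊔ c ⊔ c′)
Extends {K = K} {L = L} ι v w =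
  ∀ x (x#0 : x # 0#) (ιx#0 : ⟦ ι ⟧ x #ᴸ 0ᴸ) → ν w (⟦ ι ⟧ x) ιx#0 ≡ ν v x x#0
  where
  open HeytingField K using (_#_; 0#)
  open HeytingField L using () renaming (_#_ to _#ᴸ_; 0# to 0ᴸ)

ExactPower : ℕ → ℕ → ℕ → Set
ExactPower p k n = (p ℕ.^ k ∣ n) × (p ℕ.^ suc k ∤ n)

IsPAdicValuation : ℕ → Valuation ℚ-field → Set
IsPAdicValuation p v = ∀ q (q≢0 : q ≢ 0ℚ) i j →
  ExactPower p i ℤ.∣ ↥ q ∣ → ExactPower p j (↧ₙ q) →
  ν v q q≢0 ≡ (+ i ℤ.- + j) ℚ./ 1

record IsCompletion {K : HeytingField a b c} {L : HeytingField a′ b′ c′}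
                    (ι : Embedding K L) (v : Valuation K) (w : Valuation L)
                    : Set (a ⊔ b ⊔ c ⊔ a′ ⊔ b′ ⊔ c′) where
  open HeytingField L using (Carrier)
  field
    extends  : Extends ι v w
    dense    : ∀ x N → ∃[ y ] Close w N x (⟦ ι ⟧ y)
    complete : (u : ℕ → Carrier) →
               (∀ N → ∃[ M ] (∀ m n → M ℕ.≤ m → M ℕ.≤ n → Close w N (u m) (u n))) →
               ∃[ l ] (∀ N → ∃[ M ] (∀ n → M ℕ.≤ n → Close w N (u n) l))

-- None of ℚₚ, ℚ̄ₚ and ℚ̄ is constructed; each is pinned down up to isomorphism
-- by its defining property.  The valuation νₚ is the unique extension of the
-- one on ℚₚ.

record PAdicSetting (p : ℕ) (a b c : Level) : Set (lsuc (a ⊔ b ⊔ c)) where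
  field
    ν-ℚ              : Valuation ℚ-field
    isPAdicValuation : IsPAdicValuation p ν-ℚ

    ℚₚ               : HeytingField a b c
    ℚ→ℚₚ             : Embedding ℚ-field ℚₚ
    ν-ℚₚ             : Valuation ℚₚ
    isCompletion     : IsCompletion ℚ→ℚₚ ν-ℚ ν-ℚₚ

    ℚ̄ₚ               : HeytingField a b c
    ℚₚ→ℚ̄ₚ            : Embedding ℚₚ ℚ̄ₚ
    ℚ̄ₚ-closure       : IsAlgebraicClosure ℚₚ→ℚ̄ₚ
    νₚ               : Valuation ℚ̄ₚ
    νₚ-extends       : Extends ℚₚ→ℚ̄ₚ ν-ℚₚ νₚ

    ℚ̄                : HeytingField a b c
    ℚ→ℚ̄              : Embedding ℚ-field ℚ̄
    ℚ̄-closure        : IsAlgebraicClosure ℚ→ℚ̄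
    ℚ̄→ℚ̄ₚ             : Embedding ℚ̄ ℚ̄ₚ

-- The points (i , ν aᵢ) are rational, so hulls and boundaries are determined by
-- their rational points and ℚ × ℚ serves in place of the real plane.

Point : Set
Point = ℚ × ℚ

Segment : Point → Point → Pred Point 0ℓ
Segment (u₁ , u₂) (v₁ , v₂) w =
  ∃[ t ] (0ℚ ℚ.≤ t × t ℚ.≤ 1ℚ ×
          w ≡ ( (1ℚ ℚ.- t) ℚ.* u₁ ℚ.+ t ℚ.* v₁
              , (1ℚ ℚ.- t) ℚ.* u₂ ℚ.+ t ℚ.* v₂ ))

-- The smallest convex set containing S.
data ConvexHull (S : Pred Point ℓ) : Pred Point ℓ where
  point   : ∀ {w} → S w → ConvexHull S w
  between : ∀ {u v w} → ConvexHull S u → ConvexHull S v → Segment u v w → ConvexHull S w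

IsPoint : Pred Point ℓ → Set ℓ
IsPoint C = ∃[ u ] C ≐ ｛ u ｝

IsLineSegment : Pred Point ℓ → Set ℓ
IsLineSegment C = ∃[ u ] ∃[ v ] (u ≢ v × C ≐ Segment u v)

module _ (C : Pred Point ℓ) where

  IsVertex : Pred Point ℓ
  IsVertex w = C w × (∀ u v → C u → C v → Segment u v w → w ≡ u ⊎ w ≡ v)

  IsLeftmostVertex : Pred Point ℓ
  IsLeftmostVertex w = IsVertex w × (∀ v → IsVertex v → proj₁ w ℚ.≤ proj₁ v)

  IsRightmostVertex : Pred Point ℓ
  IsRightmostVertex w = IsVertex w × (∀ v → IsVertex v → proj₁ v ℚ.≤ proj₁ w)

  -- No point of C lies to the right of the directed line from u to v, so
  -- for vertices u ≢ v of a convex polygon C the vertex v is the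
  -- counter-clockwise successor of u.
  CounterClockwise : Point → Point → Set ℓ
  CounterClockwise (u₁ , u₂) (v₁ , v₂) = ∀ w → C w →
    0ℚ ℚ.≤ (v₁ ℚ.- u₁) ℚ.* (proj₂ w ℚ.- u₂) ℚ.- (v₂ ℚ.- u₂) ℚ.* (proj₁ w ℚ.- u₁)

  -- Uniqueness ensures that the boundary is not traversed more than once.
  record IsLowerVertexList (vs : List Point) : Set ℓ where
    field
      vertices    : All IsVertex vs
      distinct    : Unique vs
      consecutive : Linked CounterClockwise vs
      starts      : AnyMaybe IsLeftmostVertex (head vs)
      ends        : AnyMaybe IsRightmostVertex (last vs)

data Path : List Point → Pred Point 0ℓ where
  here  : ∀ {u v vs w} → Segment u v w → Path (u ∷ v ∷ vs) w
  there : ∀ {u vs w} → Path vs w → Path (u ∷ vs) w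

LowerBoundary : Pred Point ℓ → Pred Point ℓ
LowerBoundary C w =
    ((IsPoint C ⊎ IsLineSegment C) × C w)
  ⊎ (¬ (IsPoint C ⊎ IsLineSegment C) × ∃[ vs ] (IsLowerVertexList C vs × Path vs w))

module _ {K : HeytingField a b c} (v : Valuation K) (f : Poly K) where
  open HeytingField K using (_#_; 0#)

  CoefficientPoint : Pred Point c
  CoefficientPoint (x , y) =
    ∃[ i ] Σ[ aᵢ#0 ∈ coeff K f i # 0# ] (x ≡ + i ℚ./ 1 × y ≡ ν v (coeff K f i) aᵢ#0)

  Conv : Pred Point c
  Conv = ConvexHull CoefficientPoint

  NewtonPolygon : Pred Point c
  NewtonPolygon = LowerBoundary Conv

module _ {p : ℕ} (S : PAdicSetting p a b c) where
  open PAdicSetting S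

  New : Poly ℚ̄ → Pred Point c
  New f = NewtonPolygon νₚ (mapPoly ℚ̄→ℚ̄ₚ f)

{-# OPTIONS --safe #-}
-- Let B = b₁x + ⋯ + bₙxⁿ.  Choose l with ν(l) the least of the slopes
-- (ν(bᵢ) - ν(bₙ)) / (n - i) for i < n with bᵢ ≠ 0, and rescale to the monic polynomial
-- g(x) = B(l x) / (bₙ lⁿ), which is integral and has a coefficient below the
-- leading one that is a unit.  Over the residue ring of the valuation, where
-- 1, …, n are invertible since n < p, a monic polynomial of degree n which
-- vanishes at all roots of its derivative is divisible by that derivative,
-- hence is a power (x - β)ⁿ; as g(0) = 0 and g is not xⁿ there, some critical
-- value of g has valuation 0.  The critical values of g are 0 or 1 / (bₙ lⁿ), so
-- ν(bₙ) = - n ν(l), and then integrality of g says ν(bᵢ) ≥ - i ν(l): all the points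
-- lie on or above the segment from (0 , 0) to (n , ν(bₙ)).
module Submission where

open import Defs
open import Level using (Level; _⊔_; Lift; lift)
open import Algebra.Apartness.Bundles using (HeytingField; HeytingCommutativeRing)
import Algebra.Apartness.Properties.HeytingCommutativeRing as HeytingProperties
open import Algebra.Bundles using (CommutativeRing)
open import Algebra.Morphism.Structures using (module RingMorphisms)
import Algebra.Properties.AbelianGroup as AbelianGroupProperties
import Algebra.Properties.Group as GroupProperties
import Algebra.Properties.Ring as RingProperties
import Algebra.Properties.Semiring.Exp as SemiringExp
import Algebra.Properties.Semiring.Mult as SemiringMult
import Algebra.Solver.Ring.NaturalCoefficients.Default as SemiringSolver
open import Data.Empty using (⊥; ⊥-elim)
open import Data.Integer.Base as ℤ using (+_)
import Data.Integer.Properties as ℤ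
open import Data.List.Base using (List; []; _∷_; foldr; last; length; map)
open import Data.List.Relation.Unary.All as All using (All; []; _∷_)
open import Data.List.Relation.Unary.AllPairs as AllPairs using ([]; _∷_)
open import Data.List.Relation.Unary.Any using (Any; here; there)
open import Data.List.Relation.Unary.Linked using (Linked; [-]; _∷_)
open import Data.List.Relation.Unary.Unique.Propositional using (Unique)
open import Data.Maybe.Base as Maybe using ()
open import Data.Maybe.Relation.Unary.Any using (just) renaming (Any to AnyMaybe)
open import Data.Nat.Base as ℕ using (ℕ; zero; suc; _<_; z≤n; s≤s)
open import Data.Nat.Coprimality as Coprimality using (1-coprimeTo)
open import Data.Nat.Divisibility using (_∤_; 1∣_; >⇒∤)
open import Data.Nat.Primality using (Prime)
import Data.Nat.Properties as ℕ
open import Data.Product.Base using (Σ-syntax; ∃-syntax; _×_; _,_; proj₁; proj₂)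
open import Data.Rational.Base as ℚ using (ℚ; 0ℚ; 1ℚ; mkℚ)
import Data.Rational.Properties as ℚ
open import Data.Rational.Solver using (module +-*-Solver)
open import Data.Rational.Unnormalised.Base as ℚᵘ using (mkℚᵘ)
import Data.Rational.Unnormalised.Properties as ℚᵘ
open import Data.Sum.Base using (_⊎_; inj₁; inj₂; [_,_]′)
open import Data.Unit.Base using (⊤; tt)
open import Relation.Binary.Bundles using (Setoid)
open import Relation.Binary.Definitions using (Tri; tri<; tri≈; tri>)
open import Relation.Binary.PropositionalEquality as ≡ using (_≡_; _≢_)
import Relation.Binary.Reasoning.Setoid as SetoidReasoning
open import Relation.Binary.Structures using (IsEquivalence)
open import Relation.Nullary.Decidable.Core using (yes; no)
open import Relation.Nullary.Negation.Core using (¬_)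
open import Relation.Unary using (Pred; _≐_)

-- Critical points of g may collide modulo the maximal ideal, so vanishing at each of them does not
-- by itself give divisibility by g′. Multiplicities settle this: a root of f at which f′ vanishes
-- to order m is a root of f of order m + 1, provided that 1, ..., m can be cancelled, which n < p
-- guarantees. The residue ring is not shown to be algebraically closed; its critical points come
-- from splitting g′ / n over the valuation ring and reducing that factorisation.
--
-- It is not known beforehand that 1 is a critical value, hence not that u = 1 / (bₙ lⁿ) is
-- integral. What gets refuted is therefore the implication "if u is integral, then u is small",
-- which covers ν(u) > 0 and ν(u) < 0 alike and leaves ν(u) = 0.
--
-- Constructively the argument rests on deciding whether an element is zero. This is possible in ℚ̄,
-- whose elements are algebraic over ℚ, but is not assumed of ℚ̄ₚ; hence the work is done in ℚ̄ with
-- the restricted valuation, and only the final points are transported.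

private
  variable
    a b c a′ b′ c′ ℓ : Level

-- Polynomials as coefficient lists over a commutative ring

-- These depend on the operations of a ring but not on its equality, so that
-- one list is a polynomial both over a ring and over its quotients.
module PolynomialOperations {A : Set a} (_+_ _*_ : A → A → A) (-_ : A → A) (0# 1# : A) where

  infixl 6 _⊞_
  infixl 7 _⊡_

  coefficient : List A → ℕ → A
  coefficient []      _       = 0#
  coefficient (k ∷ _) zero    = k
  coefficient (_ ∷ f) (suc i) = coefficient f i

  evaluate : List A → A → A
  evaluate f x = foldr (λ k r → k + (x * r)) 0# f

  opaque
    _⊞_ : List A → List A → List A
    []      ⊞ g       = g
    (k ∷ f) ⊞ []      = k ∷ f
    (k ∷ f) ⊞ (l ∷ g) = (k + l) ∷ (f ⊞ g)

    _⊡_ : A → List A → List A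
    c ⊡ []      = []
    c ⊡ (k ∷ f) = (c * k) ∷ (c ⊡ f)

    mulLinear : A → List A → List A
    mulLinear t f = (0# ∷ f) ⊞ ((- t) ⊡ f)

  mulLinears : List A → List A → List A
  mulLinears []       f = f
  mulLinears (t ∷ ts) f = mulLinear t (mulLinears ts f)

  differentiateFrom : A → List A → List A
  differentiateFrom c []      = []
  differentiateFrom c (k ∷ f) = (c * k) ∷ differentiateFrom (1# + c) f

  differentiate : List A → List A
  differentiate []      = []
  differentiate (_ ∷ f) = differentiateFrom (1# + 0#) f

  -- The intermediate results of Horner's scheme at `t`. The first of them is the value of the
  -- polynomial, and the others are the coefficients of its quotient by x - t; `quotient` keeps the
  -- latter.
  suffixValues : A → List A → List A
  suffixValues t []      = []
  suffixValues t (k ∷ f) = evaluate (k ∷ f) t ∷ suffixValues t f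

  quotient : A → List A → List A
  quotient t []      = []
  quotient t (_ ∷ f) = suffixValues t f

module PolynomialRing (R : CommutativeRing c ℓ) where
  open CommutativeRing R
  open PolynomialOperations _+_ _*_ -_ 0# 1# public
  open RingProperties ring using (-‿distribˡ-*; +-cancelʳ)
  open SemiringMult semiring using () renaming (_×_ to _·_)
  open SemiringSolver commutativeSemiring using (solve; _:+_; _:*_; _:=_; con)
  open SetoidReasoning setoid

  infix 4 _≋_
  -- Comparing coefficients identifies lists that differ by trailing zeros. Being a record, it lets
  -- unification recover `f` and `g`, which pointwise equations between coefficients would not.
  record _≋_ (f g : List Carrier) : Set ℓ where
    field at : ∀ i → coefficient f i ≈ coefficient g i
  open _≋_ public

  ≋-refl : ∀ {f} → f ≋ f
  ≋-refl .at i = refl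

  ≋-sym : ∀ {f g} → f ≋ g → g ≋ f
  ≋-sym p .at i = sym (p .at i)

  ≋-trans : ∀ {f g h} → f ≋ g → g ≋ h → f ≋ h
  ≋-trans p q .at i = trans (p .at i) (q .at i)

  ≋-setoid : Setoid c ℓ
  ≋-setoid = record { Carrier = List Carrier ; _≈_ = _≋_ ; isEquivalence = record { refl = ≋-refl ; sym = ≋-sym ; trans = ≋-trans } }

  coefficient-beyond : ∀ f {i} → length f ℕ.≤ i → coefficient f i ≡ 0#
  coefficient-beyond []      _       = ≡.refl
  coefficient-beyond (_ ∷ f) (s≤s p) = coefficient-beyond f p

  opaque
    unfolding _⊞_ _⊡_ mulLinear

    coefficient-⊞ : ∀ f g i → coefficient (f ⊞ g) i ≈ coefficient f i + coefficient g i
    coefficient-⊞ []      g       i       = sym (+-identityˡ _)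
    coefficient-⊞ (k ∷ f) []      i       = sym (+-identityʳ _)
    coefficient-⊞ (k ∷ f) (l ∷ g) zero    = refl
    coefficient-⊞ (k ∷ f) (l ∷ g) (suc i) = coefficient-⊞ f g i

    coefficient-⊡ : ∀ k f i → coefficient (k ⊡ f) i ≈ k * coefficient f i
    coefficient-⊡ k []      i       = sym (zeroʳ k)
    coefficient-⊡ k (l ∷ f) zero    = refl
    coefficient-⊡ k (l ∷ f) (suc i) = coefficient-⊡ k f i

    coefficient-mulLinear-zero : ∀ t f → coefficient (mulLinear t f) 0 ≈ - t * coefficient f 0
    coefficient-mulLinear-zero t f =
      trans (coefficient-⊞ (0# ∷ f) (- t ⊡ f) 0) (trans (+-identityˡ _) (coefficient-⊡ (- t) f 0))

    coefficient-mulLinear-suc : ∀ t f i →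
      coefficient (mulLinear t f) (suc i) ≈ coefficient f i + - t * coefficient f (suc i)
    coefficient-mulLinear-suc t f i =
      trans (coefficient-⊞ (0# ∷ f) (- t ⊡ f) (suc i)) (+-congˡ (coefficient-⊡ (- t) f (suc i)))

  coefficient-differentiate : ∀ f i → coefficient (differentiate f) i ≈ suc i · 1# * coefficient f (suc i)
  coefficient-differentiate []      i = sym (zeroʳ _)
  coefficient-differentiate (_ ∷ f) i = from 1 f i
    where
    from : ∀ m f i → coefficient (differentiateFrom (m · 1#) f) i ≈ (m ℕ.+ i) · 1# * coefficient f i
    from m []      i       = sym (zeroʳ _)
    from m (k ∷ f) zero    rewrite ℕ.+-identityʳ m = refl
    from m (k ∷ f) (suc i) rewrite ℕ.+-suc m i = from (suc m) f i

  evaluate-cong : ∀ {f g} t → f ≋ g → evaluate f t ≈ evaluate g t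
  evaluate-cong {f} {g} t p = pointwise f g (p .at)
    where
    pointwise : ∀ f g → (∀ i → coefficient f i ≈ coefficient g i) → evaluate f t ≈ evaluate g t
    pointwise []      []      p = refl
    pointwise []      (l ∷ g) p = sym (begin
      l + t * evaluate g t  ≈⟨ +-cong (sym (p 0)) (*-congˡ (sym (pointwise [] g (λ i → p (suc i))))) ⟩
      0# + t * 0#           ≈⟨ +-identityˡ _ ⟩
      t * 0#                ≈⟨ zeroʳ t ⟩
      0#                    ∎)
    pointwise (k ∷ f) []      p = begin
      k + t * evaluate f t  ≈⟨ +-cong (p 0) (*-congˡ (pointwise f [] (λ i → p (suc i)))) ⟩
      0# + t * 0#           ≈⟨ +-identityˡ _ ⟩
      t * 0#                ≈⟨ zeroʳ t ⟩
      0#                    ∎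
    pointwise (k ∷ f) (l ∷ g) p = +-cong (p 0) (*-congˡ (pointwise f g (λ i → p (suc i))))

  opaque
    unfolding _⊞_ _⊡_ mulLinear

    evaluate-⊞ : ∀ f g t → evaluate (f ⊞ g) t ≈ evaluate f t + evaluate g t
    evaluate-⊞ []      g       t = sym (+-identityˡ _)
    evaluate-⊞ (k ∷ f) []      t = sym (+-identityʳ _)
    evaluate-⊞ (k ∷ f) (l ∷ g) t = begin
      (k + l) + t * evaluate (f ⊞ g) t
        ≈⟨ +-congˡ (*-congˡ (evaluate-⊞ f g t)) ⟩
      (k + l) + t * (evaluate f t + evaluate g t)
        ≈⟨ solve 5 (λ k l t x y → (k :+ l) :+ t :* (x :+ y) := (k :+ t :* x) :+ (l :+ t :* y))
             refl k l t (evaluate f t) (evaluate g t) ⟩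
      (k + t * evaluate f t) + (l + t * evaluate g t) ∎

    evaluate-⊡ : ∀ k f t → evaluate (k ⊡ f) t ≈ k * evaluate f t
    evaluate-⊡ k []      t = sym (zeroʳ k)
    evaluate-⊡ k (l ∷ f) t = trans (+-congˡ (*-congˡ (evaluate-⊡ k f t)))
      (solve 4 (λ k l t x → k :* l :+ t :* (k :* x) := k :* (l :+ t :* x)) refl k l t (evaluate f t))

    evaluate-mulLinear : ∀ s f t → evaluate (mulLinear s f) t ≈ (t - s) * evaluate f t
    evaluate-mulLinear s f t = begin
      evaluate (mulLinear s f) t
        ≈⟨ evaluate-⊞ (0# ∷ f) (- s ⊡ f) t ⟩
      (0# + t * evaluate f t) + evaluate (- s ⊡ f) t
        ≈⟨ +-cong (+-identityˡ _) (evaluate-⊡ (- s) f t) ⟩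
      t * evaluate f t + - s * evaluate f t
        ≈⟨ distribʳ _ _ _ ⟨
      (t - s) * evaluate f t ∎

  evaluate-mulLinear-root : ∀ t f → evaluate (mulLinear t f) t ≈ 0#
  evaluate-mulLinear-root t f =
    trans (evaluate-mulLinear t f t) (trans (*-congʳ (-‿inverseʳ t)) (zeroˡ _))

  ⊞-cong : ∀ {f f′ g g′} → f ≋ f′ → g ≋ g′ → f ⊞ g ≋ f′ ⊞ g′
  ⊞-cong {f} {f′} {g} {g′} p q .at i =
    trans (coefficient-⊞ f g i) (trans (+-cong (p .at i) (q .at i)) (sym (coefficient-⊞ f′ g′ i)))

  ⊡-cong : ∀ k {f g} → f ≋ g → k ⊡ f ≋ k ⊡ g
  ⊡-cong k {f} {g} p .at i =
    trans (coefficient-⊡ k f i) (trans (*-congˡ (p .at i)) (sym (coefficient-⊡ k g i)))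

  mulLinear-cong : ∀ {s t f g} → s ≈ t → f ≋ g → mulLinear s f ≋ mulLinear t g
  mulLinear-cong {s} {t} {f} {g} s≈t p .at zero = begin
    coefficient (mulLinear s f) 0 ≈⟨ coefficient-mulLinear-zero s f ⟩
    - s * coefficient f 0         ≈⟨ *-cong (-‿cong s≈t) (p .at 0) ⟩
    - t * coefficient g 0         ≈⟨ coefficient-mulLinear-zero t g ⟨
    coefficient (mulLinear t g) 0 ∎
  mulLinear-cong {s} {t} {f} {g} s≈t p .at (suc i) = begin
    coefficient (mulLinear s f) (suc i)           ≈⟨ coefficient-mulLinear-suc s f i ⟩
    coefficient f i + - s * coefficient f (suc i) ≈⟨ +-cong (p .at i) (*-cong (-‿cong s≈t) (p .at (suc i))) ⟩
    coefficient g i + - t * coefficient g (suc i) ≈⟨ coefficient-mulLinear-suc t g i ⟨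
    coefficient (mulLinear t g) (suc i)           ∎

  mulLinear-⊞ : ∀ t f g → mulLinear t (f ⊞ g) ≋ mulLinear t f ⊞ mulLinear t g
  mulLinear-⊞ t f g .at zero = begin
    coefficient (mulLinear t (f ⊞ g)) 0
      ≈⟨ trans (coefficient-mulLinear-zero t (f ⊞ g)) (*-congˡ (coefficient-⊞ f g 0)) ⟩
    - t * (coefficient f 0 + coefficient g 0)
      ≈⟨ distribˡ _ _ _ ⟩
    - t * coefficient f 0 + - t * coefficient g 0
      ≈⟨ +-cong (coefficient-mulLinear-zero t f) (coefficient-mulLinear-zero t g) ⟨
    coefficient (mulLinear t f) 0 + coefficient (mulLinear t g) 0
      ≈⟨ coefficient-⊞ (mulLinear t f) (mulLinear t g) 0 ⟨
    coefficient (mulLinear t f ⊞ mulLinear t g) 0 ∎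
  mulLinear-⊞ t f g .at (suc i) = begin
    coefficient (mulLinear t (f ⊞ g)) (suc i)
      ≈⟨ trans (coefficient-mulLinear-suc t (f ⊞ g) i)
           (+-cong (coefficient-⊞ f g i) (*-congˡ (coefficient-⊞ f g (suc i)))) ⟩
    (coefficient f i + coefficient g i) + - t * (coefficient f (suc i) + coefficient g (suc i))
      ≈⟨ solve 5 (λ t w x y z → (w :+ x) :+ t :* (y :+ z) := (w :+ t :* y) :+ (x :+ t :* z))
           refl (- t) (coefficient f i) (coefficient g i) (coefficient f (suc i)) (coefficient g (suc i)) ⟩
    (coefficient f i + - t * coefficient f (suc i)) + (coefficient g i + - t * coefficient g (suc i))
      ≈⟨ +-cong (coefficient-mulLinear-suc t f i) (coefficient-mulLinear-suc t g i) ⟨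
    coefficient (mulLinear t f) (suc i) + coefficient (mulLinear t g) (suc i)
      ≈⟨ coefficient-⊞ (mulLinear t f) (mulLinear t g) (suc i) ⟨
    coefficient (mulLinear t f ⊞ mulLinear t g) (suc i) ∎

  mulLinear-⊡ : ∀ t k f → mulLinear t (k ⊡ f) ≋ k ⊡ mulLinear t f
  mulLinear-⊡ t k f .at zero = begin
    coefficient (mulLinear t (k ⊡ f)) 0
      ≈⟨ trans (coefficient-mulLinear-zero t (k ⊡ f)) (*-congˡ (coefficient-⊡ k f 0)) ⟩
    - t * (k * coefficient f 0)
      ≈⟨ solve 3 (λ t k x → t :* (k :* x) := k :* (t :* x)) refl (- t) k (coefficient f 0) ⟩
    k * (- t * coefficient f 0)
      ≈⟨ *-congˡ (coefficient-mulLinear-zero t f) ⟨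
    k * coefficient (mulLinear t f) 0
      ≈⟨ coefficient-⊡ k (mulLinear t f) 0 ⟨
    coefficient (k ⊡ mulLinear t f) 0 ∎
  mulLinear-⊡ t k f .at (suc i) = begin
    coefficient (mulLinear t (k ⊡ f)) (suc i)
      ≈⟨ trans (coefficient-mulLinear-suc t (k ⊡ f) i)
           (+-cong (coefficient-⊡ k f i) (*-congˡ (coefficient-⊡ k f (suc i)))) ⟩
    k * coefficient f i + - t * (k * coefficient f (suc i))
      ≈⟨ solve 4 (λ t k x y → k :* x :+ t :* (k :* y) := k :* (x :+ t :* y))
           refl (- t) k (coefficient f i) (coefficient f (suc i)) ⟩
    k * (coefficient f i + - t * coefficient f (suc i))
      ≈⟨ *-congˡ (coefficient-mulLinear-suc t f i) ⟨
    k * coefficient (mulLinear t f) (suc i)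
      ≈⟨ coefficient-⊡ k (mulLinear t f) (suc i) ⟨
    coefficient (k ⊡ mulLinear t f) (suc i) ∎

  mulLinear-comm : ∀ s t f → mulLinear s (mulLinear t f) ≋ mulLinear t (mulLinear s f)
  mulLinear-comm s t f .at zero = begin
    coefficient (mulLinear s (mulLinear t f)) 0
      ≈⟨ trans (coefficient-mulLinear-zero s (mulLinear t f)) (*-congˡ (coefficient-mulLinear-zero t f)) ⟩
    - s * (- t * coefficient f 0)
      ≈⟨ solve 3 (λ s t x → s :* (t :* x) := t :* (s :* x)) refl (- s) (- t) (coefficient f 0) ⟩
    - t * (- s * coefficient f 0)
      ≈⟨ trans (coefficient-mulLinear-zero t (mulLinear s f)) (*-congˡ (coefficient-mulLinear-zero s f)) ⟨
    coefficient (mulLinear t (mulLinear s f)) 0 ∎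
  mulLinear-comm s t f .at (suc zero) = begin
    coefficient (mulLinear s (mulLinear t f)) 1
      ≈⟨ trans (coefficient-mulLinear-suc s (mulLinear t f) 0)
           (+-cong (coefficient-mulLinear-zero t f) (*-congˡ (coefficient-mulLinear-suc t f 0))) ⟩
    - t * coefficient f 0 + - s * (coefficient f 0 + - t * coefficient f 1)
      ≈⟨ solve 4 (λ s t x y → t :* x :+ s :* (x :+ t :* y) := s :* x :+ t :* (x :+ s :* y))
           refl (- s) (- t) (coefficient f 0) (coefficient f 1) ⟩
    - s * coefficient f 0 + - t * (coefficient f 0 + - s * coefficient f 1)
      ≈⟨ trans (coefficient-mulLinear-suc t (mulLinear s f) 0)
           (+-cong (coefficient-mulLinear-zero s f) (*-congˡ (coefficient-mulLinear-suc s f 0))) ⟨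
    coefficient (mulLinear t (mulLinear s f)) 1 ∎
  mulLinear-comm s t f .at (suc (suc i)) = begin
    coefficient (mulLinear s (mulLinear t f)) (suc (suc i))
      ≈⟨ trans (coefficient-mulLinear-suc s (mulLinear t f) (suc i))
           (+-cong (coefficient-mulLinear-suc t f i) (*-congˡ (coefficient-mulLinear-suc t f (suc i)))) ⟩
    (x + - t * y) + - s * (y + - t * z)
      ≈⟨ solve 5 (λ s t x y z → (x :+ t :* y) :+ s :* (y :+ t :* z) := (x :+ s :* y) :+ t :* (y :+ s :* z))
           refl (- s) (- t) x y z ⟩
    (x + - s * y) + - t * (y + - s * z)
      ≈⟨ trans (coefficient-mulLinear-suc t (mulLinear s f) (suc i))
           (+-cong (coefficient-mulLinear-suc s f i) (*-congˡ (coefficient-mulLinear-suc s f (suc i)))) ⟨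
    coefficient (mulLinear t (mulLinear s f)) (suc (suc i)) ∎
    where
    x = coefficient f i
    y = coefficient f (suc i)
    z = coefficient f (suc (suc i))

  mulLinears-cong : ∀ ts {f g} → f ≋ g → mulLinears ts f ≋ mulLinears ts g
  mulLinears-cong []       p = p
  mulLinears-cong (t ∷ ts) p = mulLinear-cong refl (mulLinears-cong ts p)

  mulLinears-mulLinear : ∀ ts t f → mulLinears ts (mulLinear t f) ≋ mulLinear t (mulLinears ts f)
  mulLinears-mulLinear []       t f = ≋-refl
  mulLinears-mulLinear (s ∷ ts) t f =
    ≋-trans (mulLinear-cong refl (mulLinears-mulLinear ts t f)) (mulLinear-comm s t (mulLinears ts f))

  differentiate-cong : ∀ {f g} → f ≋ g → differentiate f ≋ differentiate g
  differentiate-cong {f} {g} p .at i =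
    trans (coefficient-differentiate f i)
      (trans (*-congˡ (p .at (suc i))) (sym (coefficient-differentiate g i)))

  differentiate-mulLinear : ∀ t f → differentiate (mulLinear t f) ≋ f ⊞ mulLinear t (differentiate f)
  differentiate-mulLinear t f .at zero = begin
    coefficient (differentiate (mulLinear t f)) 0
      ≈⟨ trans (coefficient-differentiate (mulLinear t f) 0) (*-congˡ (coefficient-mulLinear-suc t f 0)) ⟩
    1 · 1# * (coefficient f 0 + - t * coefficient f 1)
      ≈⟨ solve 3 (λ t x y → (con 1 :+ con 0) :* (x :+ t :* y) := x :+ t :* ((con 1 :+ con 0) :* y))
           refl (- t) (coefficient f 0) (coefficient f 1) ⟩
    coefficient f 0 + - t * (1 · 1# * coefficient f 1)
      ≈⟨ +-congˡ (trans (coefficient-mulLinear-zero t (differentiate f))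
           (*-congˡ (coefficient-differentiate f 0))) ⟨
    coefficient f 0 + coefficient (mulLinear t (differentiate f)) 0
      ≈⟨ coefficient-⊞ f (mulLinear t (differentiate f)) 0 ⟨
    coefficient (f ⊞ mulLinear t (differentiate f)) 0 ∎
  differentiate-mulLinear t f .at (suc i) = begin
    coefficient (differentiate (mulLinear t f)) (suc i)
      ≈⟨ trans (coefficient-differentiate (mulLinear t f) (suc i))
           (*-congˡ (coefficient-mulLinear-suc t f (suc i))) ⟩
    (1# + suc i · 1#) * (x + - t * y)
      ≈⟨ solve 4 (λ n t x y → (con 1 :+ n) :* (x :+ t :* y) := x :+ (n :* x :+ t :* ((con 1 :+ n) :* y)))
           refl (suc i · 1#) (- t) x y ⟩
    x + (suc i · 1# * x + - t * ((1# + suc i · 1#) * y))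
      ≈⟨ +-congˡ (trans (coefficient-mulLinear-suc t (differentiate f) i)
           (+-cong (coefficient-differentiate f i) (*-congˡ (coefficient-differentiate f (suc i))))) ⟨
    x + coefficient (mulLinear t (differentiate f)) (suc i)
      ≈⟨ coefficient-⊞ f (mulLinear t (differentiate f)) (suc i) ⟨
    coefficient (f ⊞ mulLinear t (differentiate f)) (suc i) ∎
    where
    x = coefficient f (suc i)
    y = coefficient f (suc (suc i))

  -- Since x - t is monic, this holds over any commutative ring: descending from an index beyond
  -- both lists, the terms in `- t` agree already and can be subtracted. The lower bound `m` is
  -- there for degree estimates, where only the high coefficients are known.
  mulLinear-cancel-≥ : ∀ t f g m →
    (∀ i → m ℕ.≤ i → coefficient (mulLinear t f) (suc i) ≈ coefficient (mulLinear t g) (suc i)) →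
    ∀ i → m ℕ.≤ i → coefficient f i ≈ coefficient g i
  mulLinear-cancel-≥ t f g m agree i m≤i =
    descend (length f ℕ.+ length g) i m≤i
      (ℕ.≤-trans (ℕ.m≤m+n _ (length g)) (ℕ.m≤m+n _ i))
      (ℕ.≤-trans (ℕ.m≤n+m _ (length f)) (ℕ.m≤m+n _ i))
    where
    descend : ∀ d i → m ℕ.≤ i → length f ℕ.≤ d ℕ.+ i → length g ℕ.≤ d ℕ.+ i →
              coefficient f i ≈ coefficient g i
    descend zero    i m≤i p q =
      reflexive (≡.trans (coefficient-beyond f p) (≡.sym (coefficient-beyond g q)))
    descend (suc d) i m≤i p q = +-cancelʳ (- t * coefficient g (suc i)) _ _ (begin
      coefficient f i + - t * coefficient g (suc i) ≈⟨ +-congˡ (*-congˡ next) ⟨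
      coefficient f i + - t * coefficient f (suc i) ≈⟨ coefficient-mulLinear-suc t f i ⟨
      coefficient (mulLinear t f) (suc i)           ≈⟨ agree i m≤i ⟩
      coefficient (mulLinear t g) (suc i)           ≈⟨ coefficient-mulLinear-suc t g i ⟩
      coefficient g i + - t * coefficient g (suc i) ∎)
      where
      next : coefficient f (suc i) ≈ coefficient g (suc i)
      next = descend d (suc i) (ℕ.m≤n⇒m≤1+n m≤i)
        (≡.subst (length f ℕ.≤_) (≡.sym (ℕ.+-suc d i)) p)
        (≡.subst (length g ℕ.≤_) (≡.sym (ℕ.+-suc d i)) q)

  mulLinear-cancel : ∀ {t f g} → mulLinear t f ≋ mulLinear t g → f ≋ g
  mulLinear-cancel {t} {f} {g} p .at i = mulLinear-cancel-≥ t f g 0 (λ i _ → p .at (suc i)) i z≤n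

  Below : ℕ → List Carrier → Set ℓ
  Below m f = ∀ i → m ℕ.≤ i → coefficient f i ≈ 0#

  below-cong : ∀ {m f g} → f ≋ g → Below m f → Below m g
  below-cong p q i m≤i = trans (sym (p .at i)) (q i m≤i)

  mulLinear-below : ∀ t f m → Below (suc m) (mulLinear t f) → Below m f
  mulLinear-below t f m p = mulLinear-cancel-≥ t f [] m λ i m≤i →
    trans (p (suc i) (s≤s m≤i)) (sym (trans (coefficient-mulLinear-suc t [] i)
      (trans (+-identityˡ _) (zeroʳ _))))

  mulLinears-below : ∀ ts f m → Below (length ts ℕ.+ m) (mulLinears ts f) → Below m f
  mulLinears-below []       f m p = p
  mulLinears-below (t ∷ ts) f m p = mulLinears-below ts f m (mulLinear-below t (mulLinears ts f) _ p)

  mulLinears-leading : ∀ ts f m → Below (suc (length ts ℕ.+ m)) (mulLinears ts f) →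
    coefficient (mulLinears ts f) (length ts ℕ.+ m) ≈ coefficient f m
  mulLinears-leading []       f m p = refl
  mulLinears-leading (t ∷ ts) f m p = begin
    coefficient (mulLinear t g) (suc n)           ≈⟨ coefficient-mulLinear-suc t g n ⟩
    coefficient g n + - t * coefficient g (suc n) ≈⟨ +-congˡ (trans (*-congˡ (q (suc n) ℕ.≤-refl)) (zeroʳ _)) ⟩
    coefficient g n + 0#                          ≈⟨ +-identityʳ _ ⟩
    coefficient g n                               ≈⟨ mulLinears-leading ts f m q ⟩
    coefficient f m                               ∎
    where
    g = mulLinears ts f
    n = length ts ℕ.+ m
    q : Below (suc n) g
    q = mulLinear-below t g (suc n) p

  mulLinears-roots : ∀ ts f → All (λ t → evaluate (mulLinears ts f) t ≈ 0#) ts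
  mulLinears-roots []       f = []
  mulLinears-roots (t ∷ ts) f = evaluate-mulLinear-root t _ ∷
    All.map (λ {s} root → trans (evaluate-mulLinear t _ s) (trans (*-congˡ root) (zeroʳ _)))
      (mulLinears-roots ts f)

  coefficient-suffixValues : ∀ t f i →
    coefficient (suffixValues t f) i ≈ coefficient f i + t * coefficient (suffixValues t f) (suc i)
  coefficient-suffixValues t []          i       = sym (trans (+-identityˡ _) (zeroʳ t))
  coefficient-suffixValues t (k ∷ [])    zero    = refl
  coefficient-suffixValues t (k ∷ l ∷ f) zero    = refl
  coefficient-suffixValues t (k ∷ f)     (suc i) = coefficient-suffixValues t f i

  coefficient-quotient : ∀ t f i → coefficient (quotient t f) i ≡ coefficient (suffixValues t f) (suc i)
  coefficient-quotient t []      i = ≡.refl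
  coefficient-quotient t (k ∷ f) i = ≡.refl

  quotient-root : ∀ t f → evaluate f t ≈ 0# → f ≋ mulLinear t (quotient t f)
  quotient-root t f root .at zero = sym (begin
    coefficient (mulLinear t (quotient t f)) 0   ≈⟨ coefficient-mulLinear-zero t (quotient t f) ⟩
    - t * coefficient (quotient t f) 0           ≈⟨ *-congˡ (reflexive (coefficient-quotient t f 0)) ⟩
    - t * s                                      ≈⟨ +-identityˡ _ ⟨
    0# + - t * s                                 ≈⟨ +-congʳ (value t f root) ⟨
    (coefficient f 0 + t * s) + - t * s          ≈⟨ +-assoc _ _ _ ⟩
    coefficient f 0 + (t * s + - t * s)          ≈⟨ +-congˡ (trans (+-congˡ (sym (-‿distribˡ-* t s))) (-‿inverseʳ _)) ⟩
    coefficient f 0 + 0#                         ≈⟨ +-identityʳ _ ⟩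
    coefficient f 0                              ∎)
    where
    s = coefficient (suffixValues t f) 1
    value : ∀ t f → evaluate f t ≈ 0# → coefficient f 0 + t * coefficient (suffixValues t f) 1 ≈ 0#
    value t []      root = trans (+-identityˡ _) (zeroʳ t)
    value t (k ∷ f) root = trans (sym (coefficient-suffixValues t (k ∷ f) 0)) root
  quotient-root t f root .at (suc i) = sym (begin
    coefficient (mulLinear t (quotient t f)) (suc i)
      ≈⟨ coefficient-mulLinear-suc t (quotient t f) i ⟩
    coefficient (quotient t f) i + - t * coefficient (quotient t f) (suc i)
      ≈⟨ +-cong (reflexive (coefficient-quotient t f i)) (*-congˡ (reflexive (coefficient-quotient t f (suc i)))) ⟩
    coefficient (suffixValues t f) (suc i) + - t * s
      ≈⟨ +-congʳ (coefficient-suffixValues t f (suc i)) ⟩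
    (coefficient f (suc i) + t * s) + - t * s
      ≈⟨ +-assoc _ _ _ ⟩
    coefficient f (suc i) + (t * s + - t * s)
      ≈⟨ +-congˡ (trans (+-congˡ (sym (-‿distribˡ-* t s))) (-‿inverseʳ _)) ⟩
    coefficient f (suc i) + 0#
      ≈⟨ +-identityʳ _ ⟩
    coefficient f (suc i) ∎)
    where
    s = coefficient (suffixValues t f) (suc (suc i))

-- Multiplicities and derivatives over an integral domain

DecidableZero : CommutativeRing c ℓ → Set (c ⊔ ℓ)
DecidableZero R = ∀ x → x ≈ 0# ⊎ ¬ x ≈ 0#
  where open CommutativeRing R

NoZeroDivisors : CommutativeRing c ℓ → Set (c ⊔ ℓ)
NoZeroDivisors R = ∀ {x y} → ¬ x ≈ 0# → x * y ≈ 0# → y ≈ 0#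
  where open CommutativeRing R

module PolynomialDomain (R : CommutativeRing c ℓ) (zero? : DecidableZero R) (cancel : NoZeroDivisors R) where
  open CommutativeRing R
  open PolynomialRing R
  open RingProperties ring using (-‿involutive; +-cancelʳ; x∙y⁻¹≈ε⇒x≈y)
  open SemiringMult semiring using (×-homo-+) renaming (_×_ to _·_)
  open SemiringSolver commutativeSemiring using (solve; _:+_; _:*_; _:=_; con)

  -- A zero of order at least `m`, given by successive cofactors rather than by higher derivatives,
  -- so that a factor x - t can be peeled off or cancelled at each step.
  Vanishes : Carrier → ℕ → List Carrier → Set (c ⊔ ℓ)
  Vanishes t zero    f = Lift _ ⊤
  Vanishes t (suc m) f = ∃[ g ] f ≋ mulLinear t g × Vanishes t m g

  vanishes-cong : ∀ t m {f g} → f ≋ g → Vanishes t m f → Vanishes t m g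
  vanishes-cong t zero    p v           = v
  vanishes-cong t (suc m) p (h , q , v) = h , ≋-trans (≋-sym p) q , v

  vanishes-mulLinear⁻¹ : ∀ t m f → Vanishes t (suc m) (mulLinear t f) → Vanishes t m f
  vanishes-mulLinear⁻¹ t m f (g , p , v) = vanishes-cong t m (≋-sym (mulLinear-cancel p)) v

  vanishes⇒root : ∀ t m f → Vanishes t (suc m) f → evaluate f t ≈ 0#
  vanishes⇒root t m f (g , p , _) = trans (evaluate-cong t p) (evaluate-mulLinear-root t g)

  -- In a domain the factor x - s is nonzero at `t`, so the root belongs to `f`. Cancelling x - t
  -- leaves the same situation for the quotient with one order less.
  vanishes-mulLinear-≉ : ∀ {s t} → ¬ t ≈ s → ∀ m f → Vanishes t m (mulLinear s f) → Vanishes t m f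
  vanishes-mulLinear-≉         t≉s zero    f v           = v
  vanishes-mulLinear-≉ {s} {t} t≉s (suc m) f (g , p , v) =
    q , f≋ , vanishes-mulLinear-≉ t≉s m q (vanishes-cong t m g≋ v)
    where
    q = quotient t f
    root : evaluate f t ≈ 0#
    root = cancel (λ t-s≈0 → t≉s (x∙y⁻¹≈ε⇒x≈y t s t-s≈0))
      (trans (sym (evaluate-mulLinear s f t)) (vanishes⇒root t m (mulLinear s f) (g , p , v)))
    f≋ : f ≋ mulLinear t q
    f≋ = quotient-root t f root
    g≋ : g ≋ mulLinear s q
    g≋ = mulLinear-cancel (≋-trans (≋-sym p) (≋-trans (mulLinear-cong refl f≋) (mulLinear-comm s t q)))

  -- `e` counts the entries of `ts` equal to `t`. It is described by its two uses: a lower bound for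
  -- the order of every multiple of the product, and exactness, by which any further order must come
  -- from the cofactor.
  multiplicity : ∀ t ts → ∃[ e ] e ℕ.≤ length ts ×
    (∀ f → Vanishes t e (mulLinears ts f)) ×
    (∀ f → Vanishes t (suc e) (mulLinears ts f) → evaluate f t ≈ 0#)
  multiplicity t []       = 0 , z≤n , (λ f → lift tt) , vanishes⇒root t 0
  multiplicity t (s ∷ ts) with multiplicity t ts | zero? (t - s)
  ... | e , e≤ , divides , exact | inj₁ t-s≈0 =
    suc e , s≤s e≤
      , (λ f → mulLinears ts f , mulLinear-cong (sym t≈s) ≋-refl , divides f)
      , (λ f v → exact f (vanishes-mulLinear⁻¹ t (suc e) _
          (vanishes-cong t _ (mulLinear-cong (sym t≈s) ≋-refl) v)))
    where
    t≈s : t ≈ s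
    t≈s = x∙y⁻¹≈ε⇒x≈y t s t-s≈0
  ... | e , e≤ , divides , exact | inj₂ t-s≉0 =
    e , ℕ.m≤n⇒m≤1+n e≤
      , (λ f → vanishes-cong t e (mulLinears-mulLinear ts s f) (divides (mulLinear s f)))
      , (λ f v → exact f (vanishes-mulLinear-≉ t≉s (suc e) _ v))
    where
    t≉s : ¬ t ≈ s
    t≉s t≈s = t-s≉0 (trans (+-congʳ t≈s) (-‿inverseʳ s))

  module _ (N : ℕ) (char : ∀ k → k ℕ.< N → ¬ suc k · 1# ≈ 0#) where

    -- The polynomial in the hypothesis is (x - t)⁻ᵏ times the derivative of
    -- (x - t)ᵏ⁺¹ f.
    vanishes-integrate : ∀ t m k f → k ℕ.+ m ℕ.≤ N →
      Vanishes t m ((suc k · 1# ⊡ f) ⊞ mulLinear t (differentiate f)) → Vanishes t m f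
    vanishes-integrate t zero    k f _     v           = v
    vanishes-integrate t (suc m) k f k+m≤N v@(g , p , w) =
      q , f≋ , vanishes-integrate t m (suc k) q (≡.subst (ℕ._≤ N) (ℕ.+-suc k m) k+m≤N)
                 (vanishes-cong t m g≋ w)
      where
      q = quotient t f
      f′ = differentiate f
      q′ = differentiate q
      root : evaluate f t ≈ 0#
      root = cancel (char k (ℕ.≤-trans (s≤s (ℕ.m≤m+n k m)) (≡.subst (ℕ._≤ N) (ℕ.+-suc k m) k+m≤N))) (begin
        suc k · 1# * evaluate f t
          ≈⟨ trans (+-cong (evaluate-⊡ _ f t) (evaluate-mulLinear-root t f′)) (+-identityʳ _) ⟨
        evaluate (suc k · 1# ⊡ f) t + evaluate (mulLinear t f′) t
          ≈⟨ evaluate-⊞ (suc k · 1# ⊡ f) (mulLinear t f′) t ⟨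
        evaluate ((suc k · 1# ⊡ f) ⊞ mulLinear t f′) t
          ≈⟨ vanishes⇒root t m _ v ⟩
        0# ∎)
        where open SetoidReasoning setoid
      f≋ : f ≋ mulLinear t q
      f≋ = quotient-root t f root
      regroup : (suc k · 1# ⊡ q) ⊞ (q ⊞ mulLinear t q′) ≋ (suc (suc k) · 1# ⊡ q) ⊞ mulLinear t q′
      regroup .at i = begin
        coefficient ((suc k · 1# ⊡ q) ⊞ (q ⊞ mulLinear t q′)) i
          ≈⟨ trans (coefficient-⊞ (suc k · 1# ⊡ q) (q ⊞ mulLinear t q′) i)
               (+-cong (coefficient-⊡ _ q i) (coefficient-⊞ q (mulLinear t q′) i)) ⟩
        suc k · 1# * x + (x + y)
          ≈⟨ solve 3 (λ n x y → n :* x :+ (x :+ y) := (con 1 :+ n) :* x :+ y) refl (suc k · 1#) x y ⟩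
        (1# + suc k · 1#) * x + y
          ≈⟨ trans (coefficient-⊞ (suc (suc k) · 1# ⊡ q) (mulLinear t q′) i)
               (+-congʳ (coefficient-⊡ _ q i)) ⟨
        coefficient ((suc (suc k) · 1# ⊡ q) ⊞ mulLinear t q′) i ∎
        where
        open SetoidReasoning setoid
        x = coefficient q i
        y = coefficient (mulLinear t q′) i
      -- With f = (x - t) q, the polynomial for `k` and `f` is x - t times the one for `suc k` and
      -- `q`; cancelling x - t restores the hypothesis with one order less.
      g≋ : g ≋ (suc (suc k) · 1# ⊡ q) ⊞ mulLinear t q′
      g≋ = mulLinear-cancel (begin
        mulLinear t g
          ≈⟨ p ⟨
        (suc k · 1# ⊡ f) ⊞ mulLinear t f′
          ≈⟨ ⊞-cong (⊡-cong _ f≋) (mulLinear-cong refl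
               (≋-trans (differentiate-cong f≋) (differentiate-mulLinear t q))) ⟩
        (suc k · 1# ⊡ mulLinear t q) ⊞ mulLinear t (q ⊞ mulLinear t q′)
          ≈⟨ ⊞-cong (mulLinear-⊡ t _ q) ≋-refl ⟨
        mulLinear t (suc k · 1# ⊡ q) ⊞ mulLinear t (q ⊞ mulLinear t q′)
          ≈⟨ mulLinear-⊞ t (suc k · 1# ⊡ q) (q ⊞ mulLinear t q′) ⟨
        mulLinear t ((suc k · 1# ⊡ q) ⊞ (q ⊞ mulLinear t q′))
          ≈⟨ mulLinear-cong refl regroup ⟩
        mulLinear t ((suc (suc k) · 1# ⊡ q) ⊞ mulLinear t q′) ∎)
        where open SetoidReasoning ≋-setoid

    -- The root gives f = (x - t) q, and the derivative of this product is the polynomial of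
    -- `vanishes-integrate` with `k` equal to 0.
    vanishes-root-differentiate : ∀ t m f → m ℕ.≤ N → evaluate f t ≈ 0# →
      Vanishes t m (differentiate f) → Vanishes t (suc m) f
    vanishes-root-differentiate t m f m≤N root v =
      q , f≋ , vanishes-integrate t m 0 q m≤N (vanishes-cong t m f′≋ v)
      where
      q = quotient t f
      f≋ : f ≋ mulLinear t q
      f≋ = quotient-root t f root
      f′≋ : differentiate f ≋ (1 · 1# ⊡ q) ⊞ mulLinear t (differentiate q)
      f′≋ = ≋-trans (differentiate-cong f≋) (≋-trans (differentiate-mulLinear t q) (⊞-cong unit ≋-refl))
        where
        unit : q ≋ 1 · 1# ⊡ q
        unit .at i = sym (trans (coefficient-⊡ _ q i) (trans (*-congʳ (+-identityʳ 1#)) (*-identityˡ _)))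

    -- Suppose that `t` occurs `e` times in the remaining list. The derivative vanishes at `t` to
    -- order at least `e`, and `t` is a root of `f`, so `f` vanishes there to order `suc e`. The
    -- remaining factors account for only `e` of these, so the cofactor `h` found by induction
    -- vanishes at `t` and yields the missing factor.
    derivative-divides : ∀ f ts g → length ts ℕ.≤ N → differentiate f ≋ mulLinears ts g →
      All (λ t → evaluate f t ≈ 0#) ts → ∃[ h ] f ≋ mulLinears ts h
    derivative-divides f []       g _  _ _              = f , ≋-refl
    derivative-divides f (t ∷ ts) g ≤N p (root ∷ roots)
      with derivative-divides f ts (mulLinear t g) (ℕ.≤-trans (ℕ.n≤1+n _) ≤N)
             (≋-trans p (≋-sym (mulLinears-mulLinear ts t g))) roots
         | multiplicity t ts
    ... | h , f≋ | e , e≤ , divides , exact =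
      quotient t h , ≋-trans f≋ (≋-trans (mulLinears-cong ts (quotient-root t h h-root))
                                         (mulLinears-mulLinear ts t (quotient t h)))
      where
      h-root : evaluate h t ≈ 0#
      h-root = exact h (vanishes-cong t (suc e) f≋ (vanishes-root-differentiate t e f
        (ℕ.≤-trans e≤ (ℕ.≤-trans (ℕ.n≤1+n _) ≤N)) root
        (vanishes-cong t e (≋-sym p) (vanishes-cong t e (mulLinears-mulLinear ts t g) (divides (mulLinear t g))))))

  -- The derivative divides f, and comparing degrees n f = (x - β) f′.  As β is
  -- the only root of f and 0 is one, β = 0.
  critical-roots⇒monomial : ∀ n f ts → n ≡ suc (length ts) →
    (∀ k → k ℕ.< n → ¬ suc k · 1# ≈ 0#) →
    coefficient f n ≈ 1# → Below (suc n) f → coefficient f 0 ≈ 0# →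
    differentiate f ≋ n · 1# ⊡ mulLinears ts (1# ∷ []) →
    All (λ t → evaluate f t ≈ 0#) ts → ¬ 1# ≈ 0# →
    ∀ i → i ℕ.< n → coefficient f i ≈ 0#
  critical-roots⇒monomial n@.(suc (length ts)) f ts ≡.refl char monic degree f0≈0 f′≋ roots 1≉0 =
    by-cases (zero? (- β))
    where
    open SetoidReasoning setoid
    mulLinears-⊡ : ∀ ts k f → mulLinears ts (k ⊡ f) ≋ k ⊡ mulLinears ts f
    mulLinears-⊡ []       k f = ≋-refl
    mulLinears-⊡ (t ∷ ts) k f = ≋-trans (mulLinear-cong refl (mulLinears-⊡ ts k f)) (mulLinear-⊡ t k _)

    factor : ∃[ h ] f ≋ mulLinears ts h
    factor = derivative-divides n char f ts (n · 1# ⊡ (1# ∷ [])) (ℕ.n≤1+n _)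
      (≋-trans f′≋ (≋-sym (mulLinears-⊡ ts _ _))) roots
    h = proj₁ factor
    f≋ = proj₂ factor

    length+1 : length ts ℕ.+ 1 ≡ n
    length+1 = ℕ.+-comm (length ts) 1
    h-leading : coefficient h 1 ≈ 1#
    h-leading = begin
      coefficient h 1
        ≈⟨ mulLinears-leading ts h 1 (≡.subst (λ m → Below (suc m) (mulLinears ts h)) (≡.sym length+1)
             (below-cong f≋ degree)) ⟨
      coefficient (mulLinears ts h) (length ts ℕ.+ 1)
        ≈⟨ reflexive (≡.cong (coefficient (mulLinears ts h)) length+1) ⟩
      coefficient (mulLinears ts h) n
        ≈⟨ f≋ .at n ⟨
      coefficient f n
        ≈⟨ monic ⟩
      1# ∎
    h-degree : Below 2 h
    h-degree = mulLinears-below ts h 2 (≡.subst (λ m → Below m (mulLinears ts h))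
      (ℕ.+-comm 2 (length ts)) (below-cong f≋ degree))

    β = - coefficient h 0
    h≋ : h ≋ mulLinear β (1# ∷ [])
    h≋ .at zero          = sym (trans (coefficient-mulLinear-zero β (1# ∷ []))
                             (trans (*-identityʳ _) (-‿involutive _)))
    h≋ .at (suc zero)    = trans h-leading (sym (trans (coefficient-mulLinear-suc β (1# ∷ []) 0)
                             (trans (+-congˡ (zeroʳ _)) (+-identityʳ _))))
    h≋ .at (suc (suc i)) = trans (h-degree _ (s≤s (s≤s z≤n)))
                             (sym (trans (coefficient-mulLinear-suc β (1# ∷ []) (suc i))
                               (trans (+-congˡ (zeroʳ _)) (+-identityʳ _))))

    nf≋ : n · 1# ⊡ f ≋ mulLinear β (differentiate f)
    nf≋ = ≋-trans (⊡-cong _ (≋-trans f≋ (≋-trans (mulLinears-cong ts h≋) (mulLinears-mulLinear ts β (1# ∷ [])))))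
            (≋-trans (≋-sym (mulLinear-⊡ β _ _)) (mulLinear-cong refl (≋-sym f′≋)))

    -- The coefficients of xⁱ in n f = (x - β) f′, with i aᵢ cancelled. The number n - i is passed
    -- as `d`, to stay clear of subtraction in the ring.
    step : ∀ i d → i ℕ.+ d ≡ n → d · 1# * coefficient f i ≈ - β * (suc i · 1# * coefficient f (suc i))
    step zero    d ≡.refl = begin
      n · 1# * coefficient f 0                    ≈⟨ coefficient-⊡ _ f 0 ⟨
      coefficient (n · 1# ⊡ f) 0                  ≈⟨ nf≋ .at 0 ⟩
      coefficient (mulLinear β (differentiate f)) 0 ≈⟨ coefficient-mulLinear-zero β (differentiate f) ⟩
      - β * coefficient (differentiate f) 0       ≈⟨ *-congˡ (coefficient-differentiate f 0) ⟩
      - β * (1 · 1# * coefficient f 1)            ∎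
    step (suc i) d 1+i+d≡n = +-cancelʳ (suc i · 1# * x) _ _ (begin
      d · 1# * x + suc i · 1# * x
        ≈⟨ trans (+-comm _ _) (sym (distribʳ _ _ _)) ⟩
      (suc i · 1# + d · 1#) * x
        ≈⟨ *-congʳ (trans (sym (×-homo-+ 1# (suc i) d)) (reflexive (≡.cong (_· 1#) 1+i+d≡n))) ⟩
      n · 1# * x
        ≈⟨ coefficient-⊡ _ f (suc i) ⟨
      coefficient (n · 1# ⊡ f) (suc i)
        ≈⟨ nf≋ .at (suc i) ⟩
      coefficient (mulLinear β (differentiate f)) (suc i)
        ≈⟨ coefficient-mulLinear-suc β (differentiate f) i ⟩
      coefficient (differentiate f) i + - β * coefficient (differentiate f) (suc i)
        ≈⟨ +-cong (coefficient-differentiate f i) (*-congˡ (coefficient-differentiate f (suc i))) ⟩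
      suc i · 1# * x + - β * (suc (suc i) · 1# * coefficient f (suc (suc i)))
        ≈⟨ +-comm _ _ ⟩
      - β * (suc (suc i) · 1# * coefficient f (suc (suc i))) + suc i · 1# * x ∎)
      where x = coefficient f (suc i)

    by-cases : - β ≈ 0# ⊎ ¬ - β ≈ 0# → ∀ i → i ℕ.< n → coefficient f i ≈ 0#
    by-cases (inj₁ -β≈0) i i<n = cancel (char d (≡.subst (suc d ℕ.≤_) i+1+d≡n (ℕ.m≤n+m (suc d) i)))
      (trans (step i (suc d) i+1+d≡n) (trans (*-congʳ -β≈0) (zeroˡ _)))
      where
      d = n ℕ.∸ suc i
      i+1+d≡n : i ℕ.+ suc d ≡ n
      i+1+d≡n = ≡.trans (ℕ.+-suc i d) (ℕ.m+[n∸m]≡n i<n)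
    by-cases (inj₂ -β≉0) i i<n = ⊥-elim (1≉0 (trans (sym monic) (all-zero n ℕ.≤-refl)))
      where
      -- When β is nonzero, the recursion can be run upwards from the vanishing constant term and
      -- would kill even the leading coefficient.
      all-zero : ∀ i → i ℕ.≤ n → coefficient f i ≈ 0#
      all-zero zero    _    = f0≈0
      all-zero (suc i) i<n = cancel (char i i<n) (cancel -β≉0
        (trans (sym (step i (n ℕ.∸ i) (ℕ.m+[n∸m]≡n (ℕ.<⇒≤ i<n))))
          (trans (*-congˡ (all-zero i (ℕ.<⇒≤ i<n))) (zeroʳ _))))

-- Field preliminaries and natural numbers inside ℚ

HasDecidableZero : HeytingField a b c → Set (a ⊔ b ⊔ c)
HasDecidableZero K = ∀ x → x ≈ 0# ⊎ x # 0#
  where open HeytingField K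

IsAlgebraicallyClosed : HeytingField a b c → Set (a ⊔ b ⊔ c)
IsAlgebraicallyClosed K = ∀ f n → HasDegree f (suc n) → ∃[ x ] IsRoot f x
  where open Polynomial K

module HeytingFieldProperties (K : HeytingField a b c) where
  open HeytingField K using (_#_; #⇒invertible; #-irrefl; #-cotrans; tight) public
  open HeytingProperties (HeytingField.heytingCommutativeRing K) public

  ring-of-field : CommutativeRing _ _
  ring-of-field = HeytingCommutativeRing.commutativeRing (HeytingField.heytingCommutativeRing K)

  open CommutativeRing ring-of-field public
  open RingProperties ring public using (-0#≈0#; -‿distribˡ-*; -‿distribʳ-*; -1*x≈-x; -‿involutive)

  x*y≈1⇒x#0 : ∀ {x y} → x * y ≈ 1# → x # 0#
  x*y≈1⇒x#0 xy≈1 = invertibleʳ⇒# (_ , trans (*-congʳ (x-0≈x _)) xy≈1)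

  -1#0 : - 1# # 0#
  -1#0 = x*y≈1⇒x#0 (trans (-1*x≈-x (- 1#)) (-‿involutive 1#))

  opaque
    #0⇒invertible : ∀ {x} → x # 0# → ∃[ y ] x * y ≈ 1#
    #0⇒invertible x#0 =
      let y , _ , xy≈1 = #⇒invertible x#0 in y , trans (*-congʳ (sym (x-0≈x _))) xy≈1

  #0-cancelˡ : ∀ {x y} → x # 0# → x * y ≈ 0# → y ≈ 0#
  #0-cancelˡ {x} {y} x#0 xy≈0 =
    let z , xz≈1 = #0⇒invertible x#0 in begin
      y            ≈⟨ *-identityˡ y ⟨
      1# * y       ≈⟨ *-congʳ (trans (*-comm z x) xz≈1) ⟨
      z * x * y    ≈⟨ trans (*-assoc z x y) (*-congˡ xy≈0) ⟩
      z * 0#       ≈⟨ zeroʳ z ⟩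
      0#           ∎
    where open SetoidReasoning setoid

p+p≡0⇒p≡0 : ∀ p → p ℚ.+ p ≡ 0ℚ → p ≡ 0ℚ
p+p≡0⇒p≡0 p eq with ℚ.<-cmp p 0ℚ
... | tri< p<0 _ _ = ⊥-elim (ℚ.<-irrefl eq (ℚ.+-mono-< p<0 p<0))
... | tri≈ _ p≡0 _ = p≡0
... | tri> _ _ 0<p = ⊥-elim (ℚ.<-irrefl (≡.sym eq) (ℚ.+-mono-< 0<p 0<p))

ℕ→ℚ : ℕ → ℚ
ℕ→ℚ n = + n ℚ./ 1

-- The division in `ℕ→ℚ` normalises by a gcd that does not reduce for a variable argument; hence the
-- detour through unnormalised rationals.
ℕ→ℚ-+ : ∀ m n → ℕ→ℚ (m ℕ.+ n) ≡ ℕ→ℚ m ℚ.+ ℕ→ℚ n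
ℕ→ℚ-+ m n = ℚ.toℚᵘ-injective (ℚᵘ.≃-trans (ℚ.toℚᵘ-fromℚᵘ (mkℚᵘ (+ (m ℕ.+ n)) 0))
  (ℚᵘ.≃-trans (ℚᵘ.*≡* cross)
    (ℚᵘ.≃-trans (ℚᵘ.≃-sym (ℚᵘ.+-cong (ℚ.toℚᵘ-fromℚᵘ (mkℚᵘ (+ m) 0)) (ℚ.toℚᵘ-fromℚᵘ (mkℚᵘ (+ n) 0))))
      (ℚᵘ.≃-sym (ℚ.toℚᵘ-homo-+ (ℕ→ℚ m) (ℕ→ℚ n))))))
  where
  cross : + (m ℕ.+ n) ℤ.* (+ 1) ≡ (+ m ℤ.* + 1 ℤ.+ + n ℤ.* + 1) ℤ.* + 1
  cross = ≡.cong (ℤ._* + 1) (≡.sym (≡.cong₂ ℤ._+_ (ℤ.*-identityʳ (+ m)) (ℤ.*-identityʳ (+ n))))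

0≤ℕ→ℚ : ∀ n → 0ℚ ℚ.≤ ℕ→ℚ n
0≤ℕ→ℚ zero    = ℚ.≤-refl
0≤ℕ→ℚ (suc n) = ≡.subst (0ℚ ℚ.≤_) (≡.sym (ℕ→ℚ-+ 1 n)) (ℚ.+-mono-≤ (ℚ.<⇒≤ (ℚ.positive⁻¹ 1ℚ)) (0≤ℕ→ℚ n))

ℕ→ℚ-mono-< : ∀ {m n} → m ℕ.< n → ℕ→ℚ m ℚ.< ℕ→ℚ n
ℕ→ℚ-mono-< {m} {n} m<n = ≡.subst₂ ℚ._<_ (ℚ.+-identityʳ (ℕ→ℚ m))
  (≡.trans (≡.sym (ℕ→ℚ-+ m (suc d))) (≡.cong ℕ→ℚ (≡.trans (ℕ.+-suc m d) (ℕ.m+[n∸m]≡n m<n))))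
  (ℚ.+-monoʳ-< (ℕ→ℚ m) (≡.subst (0ℚ ℚ.<_) (≡.sym (ℕ→ℚ-+ 1 d)) (ℚ.+-mono-<-≤ (ℚ.positive⁻¹ 1ℚ) (0≤ℕ→ℚ d))))
  where d = n ℕ.∸ suc m

ℕ→ℚ-mono-≤ : ∀ {m n} → m ℕ.≤ n → ℕ→ℚ m ℚ.≤ ℕ→ℚ n
ℕ→ℚ-mono-≤ m≤n = [ (λ m<n → ℚ.<⇒≤ (ℕ→ℚ-mono-< m<n)) , (λ m≡n → ℚ.≤-reflexive (≡.cong ℕ→ℚ m≡n)) ]′
  (ℕ.m≤n⇒m<n∨m≡n m≤n)

ℕ→ℚ-injective : ∀ {m n} → ℕ→ℚ m ≡ ℕ→ℚ n → m ≡ n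
ℕ→ℚ-injective {m} {n} eq with ℕ.<-cmp m n
... | tri< m<n _ _ = ⊥-elim (ℚ.<-irrefl eq (ℕ→ℚ-mono-< m<n))
... | tri≈ _ m≡n _ = m≡n
... | tri> _ _ n<m = ⊥-elim (ℚ.<-irrefl (≡.sym eq) (ℕ→ℚ-mono-< n<m))

-- The valuation ring and its residue ring

module ValuedField (K : HeytingField a b c) (V : Valuation K) (zero? : HasDecidableZero K) where
  open HeytingFieldProperties K
  open Valuation V
  open SemiringSolver commutativeSemiring using (solve; _:+_; _:=_)

  #⇒≉ : ∀ {x} → x # 0# → ¬ x ≈ 0#
  #⇒≉ x#0 x≈0 = proj₂ (tight _ _) x≈0 x#0

  ≉⇒# : ∀ {x} → ¬ x ≈ 0# → x # 0#
  ≉⇒# {x} x≉0 = [ (λ x≈0 → ⊥-elim (x≉0 x≈0)) , (λ x#0 → x#0) ]′ (zero? x)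

  x*y#0⇒x#0 : ∀ {x y} → x * y # 0# → x # 0#
  x*y#0⇒x#0 xy#0 = ≉⇒# λ x≈0 → #⇒≉ xy#0 (trans (*-congʳ x≈0) (zeroˡ _))

  x*y#0⇒y#0 : ∀ {x y} → x * y # 0# → y # 0#
  x*y#0⇒y#0 xy#0 = x*y#0⇒x#0 (#-congʳ (*-comm _ _) xy#0)

  x≈1⇒x#0 : ∀ {x} → x ≈ 1# → x # 0#
  x≈1⇒x#0 x≈1 = #-congʳ (sym x≈1) 1#0

  ν-irr : ∀ {x} (p q : x # 0#) → ν x p ≡ ν x q
  ν-irr p q = ν-cong p q refl

  ν-1 : (p : 1# # 0#) → ν 1# p ≡ 0ℚ
  ν-1 p = identityʳ-unique (ν 1# p) (ν 1# p) (≡.trans (≡.sym (ν-* p p (#-congʳ (sym (*-identityˡ 1#)) p)))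
    (ν-cong _ p (*-identityˡ 1#)))
    where open GroupProperties (CommutativeRing.+-group ℚ.+-*-commutativeRing) using (identityʳ-unique)

  ν-≈1 : ∀ {x} (p : x # 0#) → x ≈ 1# → ν x p ≡ 0ℚ
  ν-≈1 p x≈1 = ≡.trans (ν-cong p 1#0 x≈1) (ν-1 1#0)

  ν--1 : (p : - 1# # 0#) → ν (- 1#) p ≡ 0ℚ
  ν--1 p = p+p≡0⇒p≡0 _ (≡.trans (≡.sym (ν-* p p (x#0y#0→xy#0 p p)))
    (ν-≈1 _ (trans (-1*x≈-x (- 1#)) (-‿involutive 1#))))

  ν-neg : ∀ {x} (p : x # 0#) (q : - x # 0#) → ν (- x) q ≡ ν x p
  ν-neg {x} p q = ≡.trans (ν-cong q -1*x#0 (sym (-1*x≈-x x))) (≡.trans (ν-* -1#0 p -1*x#0)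
    (≡.trans (≡.cong (ℚ._+ ν x p) (ν--1 -1#0)) (ℚ.+-identityˡ _)))
    where
    -1*x#0 = #-congʳ (sym (-1*x≈-x x)) q

  -- Vacuous at 0, where the valuation is ∞.
  Value : (ℚ → Set) → Carrier → Set c
  Value P x = (x#0 : x # 0#) → P (ν x x#0)

  value-cong : ∀ {P x y} → x ≈ y → Value P x → Value P y
  value-cong {P} x≈y v y#0 = ≡.subst P (ν-cong (#-congʳ (sym x≈y) y#0) y#0 x≈y) (v _)

  value-0 : ∀ {P x} → x ≈ 0# → Value P x
  value-0 x≈0 x#0 = ⊥-elim (#⇒≉ x#0 x≈0)

  value-neg : ∀ {P x} → Value P x → Value P (- x)
  value-neg {P} {x} v -x#0 = ≡.subst P (≡.sym (ν-neg x#0 -x#0)) (v x#0)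
    where
    x#0 = ≉⇒# λ x≈0 → #⇒≉ -x#0 (trans (-‿cong x≈0) -0#≈0#)

  value-+ : ∀ {P x y} → (∀ {r s} → r ℚ.≤ s → P r → P s) → Value P x → Value P y → Value P (x + y)
  value-+ {P} {x} {y} mono v w x+y#0 with zero? x | zero? y
  ... | inj₁ x≈0 | _        = value-cong {P} (trans (sym (+-identityˡ y)) (+-congʳ (sym x≈0))) w x+y#0
  ... | inj₂ _   | inj₁ y≈0 = value-cong {P} (trans (sym (+-identityʳ x)) (+-congˡ (sym y≈0))) v x+y#0
  ... | inj₂ x#0 | inj₂ y#0 = mono (ν-+ x#0 y#0 x+y#0)
    ([ (λ eq → ≡.subst P (≡.sym eq) (v x#0)) , (λ eq → ≡.subst P (≡.sym eq) (w y#0)) ]′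
      (ℚ.⊓-sel (ν x x#0) (ν y y#0)))

  Integral Small : Carrier → Set c
  Integral = Value (0ℚ ℚ.≤_)
  Small    = Value (0ℚ ℚ.<_)

  integral-0 : ∀ {x} → x ≈ 0# → Integral x
  integral-0 = value-0 {0ℚ ℚ.≤_}

  small-0 : ∀ {x} → x ≈ 0# → Small x
  small-0 = value-0 {0ℚ ℚ.<_}

  integral-cong : ∀ {x y} → x ≈ y → Integral x → Integral y
  integral-cong = value-cong {0ℚ ℚ.≤_}

  small-cong : ∀ {x y} → x ≈ y → Small x → Small y
  small-cong = value-cong {0ℚ ℚ.<_}

  integral-neg : ∀ {x} → Integral x → Integral (- x)
  integral-neg = value-neg {0ℚ ℚ.≤_}

  small-neg : ∀ {x} → Small x → Small (- x)
  small-neg = value-neg {0ℚ ℚ.<_}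

  small⇒integral : ∀ {x} → Small x → Integral x
  small⇒integral s x#0 = ℚ.<⇒≤ (s x#0)

  integral-+ : ∀ {x y} → Integral x → Integral y → Integral (x + y)
  integral-+ = value-+ (λ r≤s 0≤r → ℚ.≤-trans 0≤r r≤s)

  small-+ : ∀ {x y} → Small x → Small y → Small (x + y)
  small-+ = value-+ (λ r≤s 0<r → ℚ.<-≤-trans 0<r r≤s)

  integral-* : ∀ {x y} → Integral x → Integral y → Integral (x * y)
  integral-* v w xy#0 = ≡.subst (0ℚ ℚ.≤_) (≡.sym (ν-* (x*y#0⇒x#0 xy#0) (x*y#0⇒y#0 xy#0) xy#0))
    (ℚ.+-mono-≤ (v _) (w _))

  small-* : ∀ {x y} → Integral x → Small y → Small (x * y)
  small-* v w xy#0 = ≡.subst (0ℚ ℚ.<_) (≡.sym (ν-* (x*y#0⇒x#0 xy#0) (x*y#0⇒y#0 xy#0) xy#0))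
    (ℚ.+-mono-≤-< (v _) (w _))

  integral-1 : Integral 1#
  integral-1 p = ℚ.≤-reflexive (≡.sym (ν-1 p))

  ¬small-1 : ¬ Small 1#
  ¬small-1 s = ℚ.<-irrefl (≡.sym (ν-1 1#0)) (s 1#0)

  small? : ∀ x → Small x ⊎ (Σ[ x#0 ∈ x # 0# ] ν x x#0 ℚ.≤ 0ℚ)
  small? x with zero? x
  ... | inj₁ x≈0 = inj₁ (small-0 x≈0)
  ... | inj₂ x#0 with 0ℚ ℚ.<? ν x x#0
  ...   | yes 0<ν = inj₁ λ p → ≡.subst (0ℚ ℚ.<_) (ν-irr x#0 p) 0<ν
  ...   | no  0≮ν = inj₂ (x#0 , ℚ.≮⇒≥ 0≮ν)

  integral? : ∀ x → Integral x ⊎ (Σ[ x#0 ∈ x # 0# ] ν x x#0 ℚ.< 0ℚ)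
  integral? x with zero? x
  ... | inj₁ x≈0 = inj₁ (integral-0 x≈0)
  ... | inj₂ x#0 with 0ℚ ℚ.≤? ν x x#0
  ...   | yes 0≤ν = inj₁ λ p → ≡.subst (0ℚ ℚ.≤_) (ν-irr x#0 p) 0≤ν
  ...   | no  0≰ν = inj₂ (x#0 , ℚ.≰⇒> 0≰ν)

  large⇒¬small : ∀ {x} (x#0 : x # 0#) → ν x x#0 ℚ.≤ 0ℚ → ¬ Small x
  large⇒¬small x#0 ν≤0 s = ℚ.<-irrefl ≡.refl (ℚ.<-≤-trans (s x#0) ν≤0)

  -- If `x` is not small, then ν x ≤ 0 and therefore ν y ≥ ν (x y). This is what makes the residue
  -- ring a domain.
  small-cancel : ∀ {x y} → ¬ Small x → Small (x * y) → Small y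
  small-cancel {x} {y} ¬s s y#0 with small? x
  ... | inj₁ sx           = ⊥-elim (¬s sx)
  ... | inj₂ (x#0 , νx≤0) = ℚ.<-≤-trans (s xy#0) (≡.subst₂ ℚ._≤_ (≡.sym (ν-* x#0 y#0 xy#0))
                              (ℚ.+-identityˡ _) (ℚ.+-monoˡ-≤ (ν y y#0) νx≤0))
    where xy#0 = x#0y#0→xy#0 x#0 y#0

  Element : Set _
  Element = ∃[ x ] Integral x

  infixl 6 _+ᵒ_
  infixl 7 _*ᵒ_
  _+ᵒ_ _*ᵒ_ : Element → Element → Element
  x +ᵒ y = proj₁ x + proj₁ y , integral-+ (proj₂ x) (proj₂ y)
  x *ᵒ y = proj₁ x * proj₁ y , integral-* (proj₂ x) (proj₂ y)

  -ᵒ_ : Element → Element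
  -ᵒ x = - proj₁ x , integral-neg (proj₂ x)

  0ᵒ 1ᵒ : Element
  0ᵒ = 0# , integral-0 refl
  1ᵒ = 1# , integral-1

  -- The ring laws hold for the equality of the field, hence for every coarser congruence.
  -- Instantiating this twice gives the valuation ring and the residue ring with the same carrier
  -- and operations, so reduction modulo the maximal ideal is the identity on elements and on
  -- polynomials.
  module Quotient {ℓ} (_~_ : Element → Element → Set ℓ) (isEquivalence~ : IsEquivalence _~_)
                  (≈⇒~ : ∀ {x y} → proj₁ x ≈ proj₁ y → x ~ y)
                  (+~ : ∀ {x y z w} → x ~ y → z ~ w → (x +ᵒ z) ~ (y +ᵒ w))
                  (*~ : ∀ {x y z w} → x ~ y → z ~ w → (x *ᵒ z) ~ (y *ᵒ w))
                  (-~ : ∀ {x y} → x ~ y → (-ᵒ x) ~ (-ᵒ y)) where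
    ring~ : CommutativeRing _ _
    ring~ = record
      { Carrier = Element ; _≈_ = _~_ ; _+_ = _+ᵒ_ ; _*_ = _*ᵒ_ ; -_ = -ᵒ_ ; 0# = 0ᵒ ; 1# = 1ᵒ
      ; isCommutativeRing = record
        { isRing = record
          { +-isAbelianGroup = record
            { isGroup = record
              { isMonoid = record
                { isSemigroup = record
                  { isMagma = record { isEquivalence = isEquivalence~ ; ∙-cong = +~ }
                  ; assoc = λ x y z → ≈⇒~ (+-assoc _ _ _) }
                ; identity = (λ x → ≈⇒~ (+-identityˡ _)) , (λ x → ≈⇒~ (+-identityʳ _)) }
              ; inverse = (λ x → ≈⇒~ (-‿inverseˡ _)) , (λ x → ≈⇒~ (-‿inverseʳ _))
              ; ⁻¹-cong = -~ }
            ; comm = λ x y → ≈⇒~ (+-comm _ _) }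
          ; *-cong = *~
          ; *-assoc = λ x y z → ≈⇒~ (*-assoc _ _ _)
          ; *-identity = (λ x → ≈⇒~ (*-identityˡ _)) , (λ x → ≈⇒~ (*-identityʳ _))
          ; distrib = (λ x y z → ≈⇒~ (distribˡ _ _ _)) , (λ x y z → ≈⇒~ (distribʳ _ _ _)) }
        ; *-comm = λ x y → ≈⇒~ (*-comm _ _) } }

  valuationRing : CommutativeRing _ _
  valuationRing = Quotient.ring~ (λ x y → proj₁ x ≈ proj₁ y)
    (record { refl = refl ; sym = sym ; trans = trans }) (λ p → p) +-cong *-cong -‿cong

  infix 4 _≡ₘ_
  _≡ₘ_ : Element → Element → Set c
  x ≡ₘ y = Small (proj₁ x - proj₁ y)

  ≈⇒≡ₘ : ∀ {x y} → proj₁ x ≈ proj₁ y → x ≡ₘ y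
  ≈⇒≡ₘ {x} {y} x≈y = small-0 (trans (+-congʳ x≈y) (-‿inverseʳ _))

  private
    minus-swap : ∀ x y → - (x - y) ≈ y - x
    minus-swap x y = ⁻¹-anti-homo-// x y
      where open GroupProperties +-group using (⁻¹-anti-homo-//)

    telescope : ∀ x y z → (x - y) + (y - z) ≈ x - z
    telescope x y z = trans (+-assoc x (- y) (y - z)) (+-congˡ
      (trans (sym (+-assoc (- y) y (- z))) (trans (+-congʳ (-‿inverseˡ y)) (+-identityˡ _))))

    product-difference : ∀ x y z w → z * (x - y) + y * (z - w) ≈ x * z - y * w
    product-difference x y z w = trans (+-cong
        (trans (distribˡ z x (- y)) (+-cong (*-comm z x) (trans (*-comm z (- y)) (sym (-‿distribˡ-* y z)))))
        (trans (distribˡ y z (- w)) (+-congˡ (trans (*-comm y (- w))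
          (trans (sym (-‿distribˡ-* w y)) (-‿cong (*-comm w y)))))))
      (telescope (x * z) (y * z) (y * w))

    sum-difference : ∀ x y z w → (x - y) + (z - w) ≈ (x + z) - (y + w)
    sum-difference x y z w = trans
      (solve 4 (λ x y z w → (x :+ y) :+ (z :+ w) := (x :+ z) :+ (y :+ w)) refl x (- y) z (- w))
      (+-congˡ (⁻¹-∙-comm y w))
      where open AbelianGroupProperties +-abelianGroup using (⁻¹-∙-comm)

    neg-difference : ∀ x y → - (x - y) ≈ - x - - y
    neg-difference x y = sym (⁻¹-∙-comm x (- y))
      where open AbelianGroupProperties +-abelianGroup using (⁻¹-∙-comm)

  residueRing : CommutativeRing _ _
  residueRing = Quotient.ring~ _≡ₘ_
    (record
      { refl  = λ {x} → ≈⇒≡ₘ {x} {x} refl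
      ; sym   = λ s → small-cong (minus-swap _ _) (small-neg s)
      ; trans = λ s t → small-cong (telescope _ _ _) (small-+ s t) })
    (λ {x} {y} → ≈⇒≡ₘ {x} {y})
    (λ s t → small-cong (sum-difference _ _ _ _) (small-+ s t))
    (λ {x} {y} {z} {w} s t → small-cong (product-difference _ _ _ _)
      (small-+ (small-* (proj₂ z) s) (small-* (proj₂ y) t)))
    (λ s → small-cong (neg-difference _ _) (small-neg s))

-- Splitting over the valuation ring, roots and rescaling

module AlgebraicallyClosed
  (K : HeytingField a b c) (V : Valuation K) (zero? : HasDecidableZero K) (closed : IsAlgebraicallyClosed K) where
  open HeytingFieldProperties K
  open ValuedField K V zero?
  open Valuation V
  open Polynomial K using (IsRoot; coeff; eval; derivative)
  open GroupProperties +-group using (x∙y⁻¹≈ε⇒x≈y)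
  open SemiringMult semiring using (×-assoc-*; ×-congʳ) renaming (_×_ to _·_)
  open SemiringExp semiring using (_^_)
  open SemiringSolver commutativeSemiring using (solve; _:+_; _:*_; _:=_)
  module Kₓ = PolynomialRing ring-of-field
  module Oₓ = PolynomialRing valuationRing

  coeff≡coefficient : ∀ f i → coeff f i ≡ Kₓ.coefficient f i
  coeff≡coefficient []      i       = ≡.refl
  coeff≡coefficient (_ ∷ f) zero    = ≡.refl
  coeff≡coefficient (_ ∷ f) (suc i) = coeff≡coefficient f i

  coefficient-map : ∀ f i → Kₓ.coefficient (map proj₁ f) i ≡ proj₁ (Oₓ.coefficient f i)
  coefficient-map []      i       = ≡.refl
  coefficient-map (_ ∷ f) zero    = ≡.refl
  coefficient-map (_ ∷ f) (suc i) = coefficient-map f i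

  evaluate-map : ∀ f t → proj₁ (Oₓ.evaluate f t) ≡ Kₓ.evaluate (map proj₁ f) (proj₁ t)
  evaluate-map []      t = ≡.refl
  evaluate-map (k ∷ f) t = ≡.cong (λ r → proj₁ k + proj₁ t * r) (evaluate-map f t)

  differentiate-map : ∀ f → map proj₁ (Oₓ.differentiate f) ≡ Kₓ.differentiate (map proj₁ f)
  differentiate-map []      = ≡.refl
  differentiate-map (_ ∷ f) = from (1ᵒ +ᵒ 0ᵒ) f
    where
    from : ∀ m f → map proj₁ (Oₓ.differentiateFrom m f) ≡ Kₓ.differentiateFrom (proj₁ m) (map proj₁ f)
    from m []      = ≡.refl
    from m (k ∷ f) = ≡.cong (proj₁ m * proj₁ k ∷_) (from (1ᵒ +ᵒ m) f)

  integralLift : ∀ f → (∀ i → Integral (Kₓ.coefficient f i)) → Σ[ g ∈ List Element ] map proj₁ g ≡ f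
  integralLift []      int = [] , ≡.refl
  integralLift (k ∷ f) int with integralLift f (λ i → int (suc i))
  ... | g , eq = (k , int 0) ∷ g , ≡.cong (k ∷_) eq

  large-* : ∀ {x y} (x#0 : x # 0#) → ν x x#0 ℚ.< 0ℚ → ¬ Small y → ¬ Integral (x * y)
  large-* {x} {y} x#0 νx<0 ¬s int with small? y
  ... | inj₁ s             = ¬s s
  ... | inj₂ (y#0 , νy≤0) = ℚ.<-irrefl ≡.refl (ℚ.≤-<-trans (int xy#0)
          (≡.subst (ℚ._< 0ℚ) (≡.sym (ν-* x#0 y#0 xy#0)) (ℚ.+-mono-<-≤ νx<0 νy≤0)))
    where xy#0 = x#0y#0→xy#0 x#0 y#0

  -- Integral closedness through Horner's scheme. Write the value as k + t e, where e is by
  -- induction not small. If the sum were small, then t e would be integral, although ν t < 0 and ν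
  -- e ≤ 0.
  monic-value-large : ∀ N f t (t#0 : t # 0#) → ν t t#0 ℚ.< 0ℚ → (∀ i → Integral (Kₓ.coefficient f i)) →
    Kₓ.coefficient f N ≈ 1# → Kₓ.Below (suc N) f → ¬ Small (Kₓ.evaluate f t)
  monic-value-large N       []      t t#0 νt<0 int monic below s = #⇒≉ 1#0 (sym monic)
  monic-value-large zero    (k ∷ f) t t#0 νt<0 int monic below s = ¬small-1 (small-cong (begin
    k + t * Kₓ.evaluate f t  ≈⟨ +-cong monic (*-congˡ (Kₓ.evaluate-cong {f} {[]} t f≋[])) ⟩
    1# + t * 0#              ≈⟨ trans (+-congˡ (zeroʳ t)) (+-identityʳ _) ⟩
    1#                       ∎) s)
    where
    open SetoidReasoning setoid
    f≋[] : f Kₓ.≋ []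
    f≋[] .Kₓ.at i = below (suc i) (s≤s z≤n)
  monic-value-large (suc N) (k ∷ f) t t#0 νt<0 int monic below s =
    large-* t#0 νt<0
      (monic-value-large N f t t#0 νt<0 (λ i → int (suc i)) monic (λ i N<i → below (suc i) (s≤s N<i)))
      (integral-cong (begin
        - k + (k + t * e)  ≈⟨ +-assoc _ _ _ ⟨
        (- k + k) + t * e  ≈⟨ trans (+-congʳ (-‿inverseˡ k)) (+-identityˡ _) ⟩
        t * e              ∎)
        (integral-+ (integral-neg (int 0)) (small⇒integral s)))
    where
    open SetoidReasoning setoid
    e = Kₓ.evaluate f t

  -- The closed field supplies a root. It lies in the valuation ring, because outside of it the
  -- values of a monic integral polynomial are not small, whereas 0 is.
  integral-root : ∀ N f → proj₁ (Oₓ.coefficient f (suc N)) ≈ 1# → Oₓ.Below (suc (suc N)) f →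
    ∃[ t ] proj₁ (Oₓ.evaluate f t) ≈ 0#
  integral-root N f monic below = from-root (closed (map proj₁ f) N
      (#-congʳ (sym (trans (reflexive (coeff≡coefficient (map proj₁ f) (suc N))) monic′)) 1#0
      , λ i N<i → trans (reflexive (coeff≡coefficient (map proj₁ f) i)) (below′ i N<i)))
    where
    monic′ : Kₓ.coefficient (map proj₁ f) (suc N) ≈ 1#
    monic′ = trans (reflexive (coefficient-map f (suc N))) monic
    below′ : Kₓ.Below (suc (suc N)) (map proj₁ f)
    below′ i N<i = trans (reflexive (coefficient-map f i)) (below i N<i)
    integral-coefficients : ∀ i → Integral (Kₓ.coefficient (map proj₁ f) i)
    integral-coefficients i = integral-cong (reflexive (≡.sym (coefficient-map f i))) (proj₂ (Oₓ.coefficient f i))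
    from-root : ∃[ t ] IsRoot (map proj₁ f) t → ∃[ t ] proj₁ (Oₓ.evaluate f t) ≈ 0#
    from-root (t , root) =
      [ (λ int → (t , int) , trans (reflexive (evaluate-map f (t , int))) root)
      , (λ (t#0 , νt<0) → ⊥-elim (monic-value-large (suc N) (map proj₁ f) t t#0 νt<0
          integral-coefficients monic′ below′ (small-0 root))) ]′ (integral? t)

  splits : ∀ N f → proj₁ (Oₓ.coefficient f N) ≈ 1# → Oₓ.Below (suc N) f →
    ∃[ ts ] length ts ≡ N × f Oₓ.≋ Oₓ.mulLinears ts (1ᵒ ∷ [])
  splits zero    f monic below = [] , ≡.refl , f≋
    where
    f≋ : f Oₓ.≋ (1ᵒ ∷ [])
    f≋ .Oₓ.at zero    = monic
    f≋ .Oₓ.at (suc i) = below (suc i) (s≤s z≤n)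
  splits (suc N) f monic below =
    let t , root = integral-root N f monic below
        q = Oₓ.quotient t f
        f≋ = Oₓ.quotient-root t f root
        below′ = Oₓ.below-cong f≋ below
        ts , length≡ , q≋ = splits N q
          (trans (sym (Oₓ.mulLinears-leading (t ∷ []) q N below′)) (trans (sym (f≋ .Oₓ.at (suc N))) monic))
          (Oₓ.mulLinear-below t q (suc N) below′)
    in t ∷ ts , ≡.cong suc length≡ , Oₓ.≋-trans f≋ (Oₓ.mulLinear-cong {t} {t} refl q≋)

  monomial : ℕ → List Carrier
  monomial zero    = 1# ∷ []
  monomial (suc m) = 0# ∷ monomial m

  opaque
    nth-root : ∀ m k → ∃[ x ] x ^ suc m ≈ k
    nth-root m k = from-root (closed (- k ∷ monomial m) m
        (#-congʳ (sym (leading m)) 1#0 , λ { (suc i) (s≤s m<i) → beyond m i m<i }))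
      where
      leading : ∀ m → coeff (monomial m) m ≈ 1#
      leading zero    = refl
      leading (suc m) = leading m
      beyond : ∀ m i → m ℕ.< i → coeff (monomial m) i ≈ 0#
      beyond zero    (suc i) _         = refl
      beyond (suc m) (suc i) (s≤s m<i) = beyond m i m<i
      value : ∀ m x → eval (monomial m) x ≈ x ^ m
      value zero    x = trans (+-congˡ (zeroʳ x)) (+-identityʳ 1#)
      value (suc m) x = trans (+-identityˡ _) (*-congˡ (value m x))
      from-root : ∃[ x ] IsRoot (- k ∷ monomial m) x → ∃[ x ] x ^ suc m ≈ k
      from-root (x , root) = x , x∙y⁻¹≈ε⇒x≈y _ k (trans (+-comm _ _) (trans (+-congˡ (*-congˡ (sym (value m x)))) root))

  ^-#0 : ∀ {x} → x # 0# → ∀ n → x ^ n # 0#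
  ^-#0 x#0 zero    = 1#0
  ^-#0 x#0 (suc n) = x#0y#0→xy#0 x#0 (^-#0 x#0 n)

  ν-^ : ∀ {x} (x#0 : x # 0#) n (p : x ^ n # 0#) → ν (x ^ n) p ≡ ℕ→ℚ n ℚ.* ν x x#0
  ν-^ {x} x#0 zero    p = ≡.trans (ν-1 p) (≡.sym (ℚ.*-zeroˡ (ν x x#0)))
  ν-^ {x} x#0 (suc n) p = begin
    ν (x * x ^ n) p                           ≡⟨ ν-* x#0 (^-#0 x#0 n) p ⟩
    ν x x#0 ℚ.+ ν (x ^ n) (^-#0 x#0 n)        ≡⟨ ≡.cong₂ ℚ._+_ (≡.sym (ℚ.*-identityˡ (ν x x#0))) (ν-^ x#0 n (^-#0 x#0 n)) ⟩
    1ℚ ℚ.* ν x x#0 ℚ.+ ℕ→ℚ n ℚ.* ν x x#0      ≡⟨ ℚ.*-distribʳ-+ (ν x x#0) 1ℚ (ℕ→ℚ n) ⟨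
    (1ℚ ℚ.+ ℕ→ℚ n) ℚ.* ν x x#0                ≡⟨ ≡.cong (ℚ._* ν x x#0) (ℕ→ℚ-+ 1 n) ⟨
    ℕ→ℚ (suc n) ℚ.* ν x x#0                   ∎
    where open ≡.≡-Reasoning

  -- The polynomial u f(l x); the power of `l` is accumulated in the first argument.
  rescale : Carrier → Carrier → List Carrier → List Carrier
  rescale u l []      = []
  rescale u l (k ∷ f) = u * k ∷ rescale (u * l) l f

  coefficient-rescale : ∀ u l f i → Kₓ.coefficient (rescale u l f) i ≈ u * (l ^ i * Kₓ.coefficient f i)
  coefficient-rescale u l []      i       = sym (trans (*-congˡ (zeroʳ _)) (zeroʳ u))
  coefficient-rescale u l (k ∷ f) zero    = *-congˡ (sym (*-identityˡ k))
  coefficient-rescale u l (k ∷ f) (suc i) = trans (coefficient-rescale (u * l) l f i)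
    (solve 4 (λ u l p x → (u :* l) :* (p :* x) := u :* ((l :* p) :* x)) refl u l (l ^ i) (Kₓ.coefficient f i))

  evaluate-rescale : ∀ u l f t → Kₓ.evaluate (rescale u l f) t ≈ u * Kₓ.evaluate f (l * t)
  evaluate-rescale u l []      t = sym (zeroʳ u)
  evaluate-rescale u l (k ∷ f) t = trans (+-congˡ (*-congˡ (evaluate-rescale (u * l) l f t)))
    (solve 5 (λ u l k t x → u :* k :+ t :* ((u :* l) :* x) := u :* (k :+ (l :* t) :* x))
      refl u l k t (Kₓ.evaluate f (l * t)))

  evaluate-differentiate-rescale : ∀ u l f t →
    Kₓ.evaluate (Kₓ.differentiate (rescale u l f)) t ≈ (u * l) * Kₓ.evaluate (Kₓ.differentiate f) (l * t)
  evaluate-differentiate-rescale u l []      t = sym (zeroʳ (u * l))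
  evaluate-differentiate-rescale u l (k ∷ f) t = from (1# + 0#) (u * l) f
    where
    from : ∀ m u f → Kₓ.evaluate (Kₓ.differentiateFrom m (rescale u l f)) t ≈
                     u * Kₓ.evaluate (Kₓ.differentiateFrom m f) (l * t)
    from m u []      = sym (zeroʳ u)
    from m u (k ∷ f) = trans (+-congˡ (*-congˡ (from (1# + m) (u * l) f)))
      (solve 6 (λ m u l k t x → m :* (u :* k) :+ t :* ((u :* l) :* x) := u :* (m :* k :+ (l :* t) :* x))
        refl m u l k t (Kₓ.evaluate (Kₓ.differentiateFrom (1# + m) f) (l * t)))

  private
    scaleFrom : ℕ → List Carrier → List Carrier
    scaleFrom m []      = []
    scaleFrom m (k ∷ f) = m · k ∷ scaleFrom (suc m) f

    satisfies-equations⇒scaleFrom : (s : ℕ → List Carrier → List Carrier) → (∀ m → s m [] ≡ []) →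
      (∀ m k f → s m (k ∷ f) ≡ m · k ∷ s (suc m) f) → ∀ m f → s m f ≡ scaleFrom m f
    satisfies-equations⇒scaleFrom s nil cons m []      = nil m
    satisfies-equations⇒scaleFrom s nil cons m (k ∷ f) =
      ≡.trans (cons m k f) (≡.cong (m · k ∷_) (satisfies-equations⇒scaleFrom s nil cons (suc m) f))

    -- The function in the where block of derivative has no name in scope;
    -- unification finds it, once the initial index 1 is generalised.
    mutual
      hidden : Carrier → ℕ → List Carrier → List Carrier
      hidden = _

      derivative≡scaleFrom : ∀ x f m → m ≡ 1 → derivative (x ∷ f) ≡ scaleFrom m f
      derivative≡scaleFrom x f m eq rewrite ≡.sym eq =
        satisfies-equations⇒scaleFrom (hidden x) (λ _ → ≡.refl) (λ _ _ _ → ≡.refl) m f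

  evaluate-derivative : ∀ f t → eval (derivative f) t ≈ Kₓ.evaluate (Kₓ.differentiate f) t
  evaluate-derivative []      t = refl
  evaluate-derivative (k ∷ f) t =
    trans (reflexive (≡.cong (λ g → eval g t) (derivative≡scaleFrom k f 1 ≡.refl))) (from 1 f)
    where
    from : ∀ m f → eval (scaleFrom m f) t ≈ Kₓ.evaluate (Kₓ.differentiateFrom (m · 1#) f) t
    from m []      = refl
    from m (l ∷ f) = +-cong (trans (×-congʳ m (sym (*-identityˡ l))) (sym (×-assoc-* m 1# l)))
                       (*-congˡ (from (suc m) f))

-- From the critical values to the slope of the polygon

module CriticalValues
  (K : HeytingField a b′ c) (V : Valuation K) (zero? : HasDecidableZero K) (closed : IsAlgebraicallyClosed K) where
  open HeytingFieldProperties K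
  open ValuedField K V zero?
  open AlgebraicallyClosed K V zero? closed
  open Valuation V
  open Polynomial K using (IsRoot; IsZeroOrOne; eval; derivative)
  open SemiringMult semiring using () renaming (_×_ to _·_)
  open SemiringMult (CommutativeRing.semiring valuationRing) using () renaming (_×_ to _·ᵒ_)
  open SemiringMult (CommutativeRing.semiring residueRing) using () renaming (_×_ to _·ₘ_)
  open SemiringExp semiring using (_^_; ^-homo-*; ^-congʳ)

  ·ᵒ≈ : ∀ n → proj₁ (n ·ᵒ 1ᵒ) ≈ n · 1#
  ·ᵒ≈ zero    = refl
  ·ᵒ≈ (suc n) = +-congˡ (·ᵒ≈ n)

  ·ₘ≈ : ∀ n → proj₁ (n ·ₘ 1ᵒ) ≈ n · 1#
  ·ₘ≈ zero    = refl
  ·ₘ≈ (suc n) = +-congˡ (·ₘ≈ n)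

  small⇒≡ₘ0 : ∀ {x} → Small (proj₁ x) → x ≡ₘ 0ᵒ
  small⇒≡ₘ0 = small-cong (sym (x-0≈x _))

  ≡ₘ0⇒small : ∀ {x} → x ≡ₘ 0ᵒ → Small (proj₁ x)
  ≡ₘ0⇒small = small-cong (x-0≈x _)

  residue-zero? : ∀ x → x ≡ₘ 0ᵒ ⊎ ¬ x ≡ₘ 0ᵒ
  residue-zero? x =
    [ (λ s → inj₁ (small⇒≡ₘ0 {x} s))
    , (λ (x#0 , ν≤0) → inj₂ (λ x≡0 → large⇒¬small x#0 ν≤0 (≡ₘ0⇒small {x} x≡0))) ]′ (small? (proj₁ x))

  residue-cancel : ∀ {x y} → ¬ x ≡ₘ 0ᵒ → x *ᵒ y ≡ₘ 0ᵒ → y ≡ₘ 0ᵒ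
  residue-cancel {x} {y} x≢0 xy≡0 =
    small⇒≡ₘ0 {y} (small-cancel (λ s → x≢0 (small⇒≡ₘ0 {x} s)) (≡ₘ0⇒small {x *ᵒ y} xy≡0))

  module kₓ where
    open PolynomialRing residueRing public
    open PolynomialDomain residueRing residue-zero? (λ {x} {y} → residue-cancel {x} {y}) public

  module _ (B : List Carrier) (n′ : ℕ)
           (units : ∀ k → k ℕ.< suc n′ → Σ[ p ∈ suc k · 1# # 0# ] ν (suc k · 1#) p ≡ 0ℚ)
           (bₙ#0 : Kₓ.coefficient B (suc n′) # 0#) (b₀≈0 : Kₓ.coefficient B 0 ≈ 0#)
           (b>≈0 : ∀ i → suc n′ ℕ.< i → Kₓ.coefficient B i ≈ 0#)
           (critical : ∀ x → IsRoot (derivative B) x → IsZeroOrOne (eval B x)) where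

    private
      n : ℕ
      n = suc n′

      coef : ℕ → Carrier
      coef = Kₓ.coefficient B

    -- If all critical values of u B(l x) were small, it would reduce to the
    -- monomial xⁿ, against the hypothesis on its j-th coefficient.
    critical-value-not-small : ∀ l u → l # 0# → u # 0# → u * (l ^ n * coef n) ≈ 1# →
      (∀ i → Integral (u * (l ^ i * coef i))) → ∀ j → j ℕ.< n → u * (l ^ j * coef j) ≈ 1# →
      ¬ (Integral u → Small u)
    critical-value-not-small l u l#0 u#0 leading≈1 integral j j<n jth≈1 integral⇒small =
      ¬small-1 (small-cong (trans (g≈ j) jth≈1) (≡ₘ0⇒small {Oₓ.coefficient g j}
        (kₓ.critical-roots⇒monomial n g ts (≡.cong suc (≡.sym length≡))
          char (≈⇒≡ₘ {Oₓ.coefficient g n} {1ᵒ} g-monic)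
          (λ i n<i → ≈⇒≡ₘ {Oₓ.coefficient g i} {0ᵒ} (g-below i n<i))
          (≈⇒≡ₘ {Oₓ.coefficient g 0} {0ᵒ} g₀≈0) g′≋
          (All.map (λ {t} root → small⇒≡ₘ0 {Oₓ.evaluate g t} (small-at t root)) roots)
          (λ 1≡0 → ¬small-1 (≡ₘ0⇒small {1ᵒ} 1≡0)) j j<n)))
      where
      open SetoidReasoning setoid
      lifted : Σ[ g ∈ List Element ] map proj₁ g ≡ rescale u l B
      lifted = integralLift (rescale u l B) (λ i → integral-cong (sym (coefficient-rescale u l B i)) (integral i))
      g = proj₁ lifted

      g≈ : ∀ i → proj₁ (Oₓ.coefficient g i) ≈ u * (l ^ i * coef i)
      g≈ i = begin
        proj₁ (Oₓ.coefficient g i)          ≈⟨ reflexive (coefficient-map g i) ⟨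
        Kₓ.coefficient (map proj₁ g) i      ≈⟨ reflexive (≡.cong (λ f → Kₓ.coefficient f i) (proj₂ lifted)) ⟩
        Kₓ.coefficient (rescale u l B) i    ≈⟨ coefficient-rescale u l B i ⟩
        u * (l ^ i * coef i)                   ∎

      vanishing : ∀ i → coef i ≈ 0# → proj₁ (Oₓ.coefficient g i) ≈ 0#
      vanishing i bᵢ≈0 = trans (g≈ i) (trans (*-congˡ (trans (*-congˡ bᵢ≈0) (zeroʳ _))) (zeroʳ u))

      g-monic : proj₁ (Oₓ.coefficient g n) ≈ 1#
      g-monic = trans (g≈ n) leading≈1
      g-below : ∀ i → n ℕ.< i → proj₁ (Oₓ.coefficient g i) ≈ 0#
      g-below i n<i = vanishing i (b>≈0 i n<i)
      g₀≈0 : proj₁ (Oₓ.coefficient g 0) ≈ 0#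
      g₀≈0 = vanishing 0 b₀≈0

      evaluate-g : ∀ t → proj₁ (Oₓ.evaluate g t) ≈ u * eval B (l * proj₁ t)
      evaluate-g t = begin
        proj₁ (Oₓ.evaluate g t)                   ≈⟨ reflexive (evaluate-map g t) ⟩
        Kₓ.evaluate (map proj₁ g) (proj₁ t)       ≈⟨ reflexive (≡.cong (λ f → Kₓ.evaluate f (proj₁ t)) (proj₂ lifted)) ⟩
        Kₓ.evaluate (rescale u l B) (proj₁ t)     ≈⟨ evaluate-rescale u l B (proj₁ t) ⟩
        u * eval B (l * proj₁ t)                  ∎

      g′ = Oₓ.differentiate g
      evaluate-g′ : ∀ t → proj₁ (Oₓ.evaluate g′ t) ≈ (u * l) * eval (derivative B) (l * proj₁ t)
      evaluate-g′ t = begin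
        proj₁ (Oₓ.evaluate g′ t)
          ≈⟨ reflexive (evaluate-map g′ t) ⟩
        Kₓ.evaluate (map proj₁ g′) (proj₁ t)
          ≈⟨ reflexive (≡.cong (λ f → Kₓ.evaluate f (proj₁ t))
               (≡.trans (differentiate-map g) (≡.cong Kₓ.differentiate (proj₂ lifted)))) ⟩
        Kₓ.evaluate (Kₓ.differentiate (rescale u l B)) (proj₁ t)
          ≈⟨ evaluate-differentiate-rescale u l B (proj₁ t) ⟩
        (u * l) * Kₓ.evaluate (Kₓ.differentiate B) (l * proj₁ t)
          ≈⟨ *-congˡ (evaluate-derivative B (l * proj₁ t)) ⟨
        (u * l) * eval (derivative B) (l * proj₁ t) ∎

      small-at : ∀ t → proj₁ (Oₓ.evaluate g′ t) ≈ 0# → Small (proj₁ (Oₓ.evaluate g t))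
      small-at t root =
        [ (λ B≈0 → small-0 (trans (evaluate-g t) (trans (*-congˡ B≈0) (zeroʳ u))))
        -- In this case u is a value of the integral polynomial `g` at an integral point, hence
        -- integral. Therefore the conditional hypothesis on u is enough.
        , (λ B≈1 → let g≈u = trans (evaluate-g t) (trans (*-congˡ B≈1) (*-identityʳ u)) in
                   small-cong (sym g≈u) (integral⇒small (integral-cong g≈u (proj₂ (Oₓ.evaluate g t))))) ]′
        (critical (l * proj₁ t) (#0-cancelˡ (x#0y#0→xy#0 u#0 l#0) (trans (sym (evaluate-g′ t)) root)))

      n#0 = proj₁ (units n′ ℕ.≤-refl)
      w,nw≈1 = #0⇒invertible n#0
      w = proj₁ w,nw≈1
      nw≈1 = proj₂ w,nw≈1
      integral-w : Integral w
      integral-w w#0 = ℚ.≤-reflexive (≡.sym (≡.trans (≡.sym (ℚ.+-identityˡ _))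
        (≡.trans (≡.cong (ℚ._+ ν w w#0) (≡.sym (proj₂ (units n′ ℕ.≤-refl))))
          (≡.trans (≡.sym (ν-* n#0 w#0 nw#0)) (ν-≈1 nw#0 nw≈1)))))
        where nw#0 = x≈1⇒x#0 nw≈1
      wᵒ : Element
      wᵒ = w , integral-w
      -- The derivative divided by its leading coefficient n. As n has valuation 0, its inverse `w`
      -- is integral and the quotient is a monic polynomial over the valuation ring, to which
      -- `splits` applies.
      h = wᵒ Oₓ.⊡ g′

      h≈ : ∀ i → proj₁ (Oₓ.coefficient h i) ≈ w * (suc i · 1# * proj₁ (Oₓ.coefficient g (suc i)))
      h≈ i = trans (Oₓ.coefficient-⊡ wᵒ g′ i)
        (*-congˡ (trans (Oₓ.coefficient-differentiate g i) (*-congʳ (·ᵒ≈ (suc i)))))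
      h-monic : proj₁ (Oₓ.coefficient h n′) ≈ 1#
      h-monic = trans (h≈ n′) (trans (*-congˡ (trans (*-congˡ g-monic) (*-identityʳ _)))
        (trans (*-comm w _) nw≈1))
      h-below : Oₓ.Below (suc n′) h
      h-below i n′<i = trans (h≈ i) (trans (*-congˡ (trans (*-congˡ (g-below (suc i) (s≤s n′<i))) (zeroʳ _))) (zeroʳ w))

      splitting : ∃[ ts ] length ts ≡ n′ × h Oₓ.≋ Oₓ.mulLinears ts (1ᵒ ∷ [])
      splitting = splits n′ h h-monic h-below
      ts = proj₁ splitting
      length≡ = proj₁ (proj₂ splitting)
      h≋ = proj₂ (proj₂ splitting)

      nh≈g′ : ∀ x → n · 1# * (w * x) ≈ x
      nh≈g′ x = trans (sym (*-assoc _ w x)) (trans (*-congʳ nw≈1) (*-identityˡ x))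

      -- The factorisation `h≋` holds over the valuation ring. Both rings share their operations, so
      -- its coefficients also serve modulo the maximal ideal, where equality is merely weaker.
      g′≋ : g′ kₓ.≋ n ·ₘ 1ᵒ kₓ.⊡ kₓ.mulLinears ts (1ᵒ ∷ [])
      g′≋ .kₓ.at i = k.trans {g′ᵢ} {n ·ₘ 1ᵒ *ᵒ pᵢ} {kₓ.coefficient (n ·ₘ 1ᵒ kₓ.⊡ kₓ.mulLinears ts (1ᵒ ∷ [])) i}
        (≈⇒≡ₘ {g′ᵢ} {n ·ₘ 1ᵒ *ᵒ pᵢ} (begin
          proj₁ g′ᵢ                                ≈⟨ nh≈g′ _ ⟨
          n · 1# * (w * proj₁ g′ᵢ)                 ≈⟨ *-congˡ (Oₓ.coefficient-⊡ wᵒ g′ i) ⟨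
          n · 1# * proj₁ (Oₓ.coefficient h i)      ≈⟨ *-cong (sym (·ₘ≈ n)) (h≋ .Oₓ.at i) ⟩
          proj₁ (n ·ₘ 1ᵒ) * proj₁ pᵢ               ∎))
        (k.sym {kₓ.coefficient (n ·ₘ 1ᵒ kₓ.⊡ kₓ.mulLinears ts (1ᵒ ∷ [])) i} {n ·ₘ 1ᵒ *ᵒ pᵢ}
          (kₓ.coefficient-⊡ (n ·ₘ 1ᵒ) (kₓ.mulLinears ts (1ᵒ ∷ [])) i))
        where
        module k = CommutativeRing residueRing
        g′ᵢ = Oₓ.coefficient g′ i
        pᵢ = Oₓ.coefficient (Oₓ.mulLinears ts (1ᵒ ∷ [])) i

      splitting-root : ∀ t → proj₁ (Oₓ.evaluate (Oₓ.mulLinears ts (1ᵒ ∷ [])) t) ≈ 0# →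
        proj₁ (Oₓ.evaluate g′ t) ≈ 0#
      splitting-root t root = begin
        proj₁ (Oₓ.evaluate g′ t)                  ≈⟨ nh≈g′ (proj₁ (Oₓ.evaluate g′ t)) ⟨
        n · 1# * (w * proj₁ (Oₓ.evaluate g′ t))   ≈⟨ *-congˡ (Oₓ.evaluate-⊡ wᵒ g′ t) ⟨
        n · 1# * proj₁ (Oₓ.evaluate h t)          ≈⟨ *-congˡ (Oₓ.evaluate-cong {h} {Oₓ.mulLinears ts (1ᵒ ∷ [])} t h≋) ⟩
        n · 1# * proj₁ (Oₓ.evaluate (Oₓ.mulLinears ts (1ᵒ ∷ [])) t) ≈⟨ *-congˡ root ⟩
        n · 1# * 0#                               ≈⟨ zeroʳ (n · 1#) ⟩
        0#                                        ∎

      roots : All (λ t → proj₁ (Oₓ.evaluate g′ t) ≈ 0#) ts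
      roots = All.map (λ {t} → splitting-root t) (Oₓ.mulLinears-roots ts (1ᵒ ∷ []))

      char : ∀ k → k ℕ.< n → ¬ suc k ·ₘ 1ᵒ ≡ₘ 0ᵒ
      char k k<n k≡0 = large⇒¬small (proj₁ (units k k<n)) (ℚ.≤-reflexive (proj₂ (units k k<n)))
        (small-cong (·ₘ≈ (suc k)) (≡ₘ0⇒small {suc k ·ₘ 1ᵒ} k≡0))

    private
      regroup : ∀ u v x y z → u ℚ.+ (v ℚ.+ (x ℚ.+ y) ℚ.* z) ≡ u ℚ.+ ((v ℚ.+ y ℚ.* z) ℚ.+ x ℚ.* z)
      regroup = solveℚ 5 (λ u v x y z → u :+ (v :+ (x :+ y) :* z) := u :+ ((v :+ y :* z) :+ x :* z)) ≡.refl
        where open +-*-Solver using (_:+_; _:*_; _:=_) renaming (solve to solveℚ)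

    ν-bₙ : ℚ
    ν-bₙ = ν (coef n) bₙ#0

    ν-ratio : ∀ {l x} (l#0 : l # 0#) e (x#0 : x # 0#) → l ^ e * coef n ≈ x → ν-bₙ ℚ.+ ℕ→ℚ e ℚ.* ν l l#0 ≡ ν x x#0
    ν-ratio {l} {x} l#0 e x#0 eq = begin
      ν-bₙ ℚ.+ ℕ→ℚ e ℚ.* ν l l#0            ≡⟨ ℚ.+-comm ν-bₙ _ ⟩
      ℕ→ℚ e ℚ.* ν l l#0 ℚ.+ ν-bₙ            ≡⟨ ≡.cong (ℚ._+ ν-bₙ) (ν-^ l#0 e (^-#0 l#0 e)) ⟨
      ν (l ^ e) (^-#0 l#0 e) ℚ.+ ν-bₙ       ≡⟨ ν-* (^-#0 l#0 e) bₙ#0 p ⟨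
      ν (l ^ e * coef n) p                     ≡⟨ ν-cong p x#0 eq ⟩
      ν x x#0                               ∎
      where
      open ≡.≡-Reasoning
      p = x#0y#0→xy#0 (^-#0 l#0 e) bₙ#0

    opaque
      -- Realises the slope (ν x - ν bₙ) / (m + 1) as the valuation of an element, a root of x / bₙ.
      -- Slopes can then be compared without dividing rationals, and the least one comes with the
      -- scaling factor it calls for.
      ratio-root : ∀ m {x} → x # 0# → ∃[ l ] l # 0# × l ^ suc m * coef n ≈ x
      ratio-root m {x} x#0 = l , x*y#0⇒x#0 (x*y#0⇒x#0 (#-congʳ (sym lᵐbₙ≈x) x#0)) , lᵐbₙ≈x
        where
        open SetoidReasoning setoid
        y l : Carrier
        y = proj₁ (#0⇒invertible bₙ#0)
        l = proj₁ (nth-root m (x * y))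
        lᵐbₙ≈x : l ^ suc m * coef n ≈ x
        lᵐbₙ≈x = begin
          l ^ suc m * coef n   ≈⟨ *-congʳ (proj₂ (nth-root m (x * y))) ⟩
          x * y * coef n       ≈⟨ trans (*-assoc x y (coef n)) (*-congˡ (*-comm y (coef n))) ⟩
          x * (coef n * y)     ≈⟨ trans (*-congˡ (proj₂ (#0⇒invertible bₙ#0))) (*-identityʳ x) ⟩
          x                 ∎

    -- The slopes (ν bᵢ - ν bₙ) / (n - i) for i < k are at least ν scale, with
    -- equality at attainedAt.
    record SteepestSlope (k : ℕ) : Set (a ⊔ b′ ⊔ c) where
      field
        scale      : Carrier
        scale#0    : scale # 0#
        attainedAt : ℕ
        gap        : ℕ
        gap≡       : attainedAt ℕ.+ suc gap ≡ n
        attained   : scale ^ suc gap * coef n ≈ coef attainedAt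
        minimal    : ∀ i → i ℕ.< k → ∀ e → i ℕ.+ e ≡ n → (p : coef i # 0#) →
                     ν-bₙ ℚ.+ ℕ→ℚ e ℚ.* ν scale scale#0 ℚ.≤ ν (coef i) p

    mono-slope : ∀ e {r s} → r ℚ.≤ s → ν-bₙ ℚ.+ ℕ→ℚ e ℚ.* r ℚ.≤ ν-bₙ ℚ.+ ℕ→ℚ e ℚ.* s
    mono-slope e r≤s = ℚ.+-monoʳ-≤ ν-bₙ (ℚ.*-monoˡ-≤-nonNeg (ℕ→ℚ e) r≤s)
      where instance _ = ℚ.nonNegative (0≤ℕ→ℚ e)

    split-< : ∀ {P : ℕ → Set ℓ} {k} → (∀ i → i ℕ.< k → P i) → P k → ∀ i → i ℕ.< suc k → P i
    split-< {P = P} below at i i<1+k with ℕ.m<1+n⇒m<n∨m≡n i<1+k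
    ... | inj₁ i<k    = below i i<k
    ... | inj₂ ≡.refl = at

    -- A running minimum over the indices below `k`. A vanishing coefficient imposes no condition; a
    -- nonzero one either replaces the current scale or satisfies the bound for it. The first
    -- alternative remains only while no nonzero coefficient has been met.
    steepest-slope : ∀ k → k ℕ.≤ n → (∀ i → i ℕ.< k → coef i ≈ 0#) ⊎ SteepestSlope k
    steepest-slope zero    _   = inj₁ λ i ()
    steepest-slope (suc k) k<n = extend (steepest-slope k (ℕ.<⇒≤ k<n)) (zero? (coef k))
      where
      extend : (∀ i → i ℕ.< k → coef i ≈ 0#) ⊎ SteepestSlope k → coef k ≈ 0# ⊎ coef k # 0# →
               (∀ i → i ℕ.< suc k → coef i ≈ 0#) ⊎ SteepestSlope (suc k)
      extend (inj₁ zeros) (inj₁ bₖ≈0) = inj₁ (split-< zeros bₖ≈0)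
      extend (inj₂ s)     (inj₁ bₖ≈0) = inj₂ record
        { SteepestSlope s
        ; minimal = split-< (SteepestSlope.minimal s) (λ e _ p → ⊥-elim (#⇒≉ p bₖ≈0)) }
      extend previous     (inj₂ bₖ#0) = compare previous
        where
        gap = n ℕ.∸ suc k
        gap≡ : k ℕ.+ suc gap ≡ n
        gap≡ = ≡.trans (ℕ.+-suc k gap) (ℕ.m+[n∸m]≡n k<n)
        l = proj₁ (ratio-root gap bₖ#0)
        l#0 = proj₁ (proj₂ (ratio-root gap bₖ#0))
        attained = proj₂ (proj₂ (ratio-root gap bₖ#0))
        slope : ∀ e → k ℕ.+ e ≡ n → (p : coef k # 0#) → ν-bₙ ℚ.+ ℕ→ℚ e ℚ.* ν l l#0 ≡ ν (coef k) p
        slope e k+e≡n p = ≡.trans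
          (≡.cong (λ e → ν-bₙ ℚ.+ ℕ→ℚ e ℚ.* ν l l#0) (ℕ.+-cancelˡ-≡ k e (suc gap) (≡.trans k+e≡n (≡.sym gap≡))))
          (ν-ratio l#0 (suc gap) p attained)
        replace : (∀ i → i ℕ.< k → ∀ e → i ℕ.+ e ≡ n → (p : coef i # 0#) →
                   ν-bₙ ℚ.+ ℕ→ℚ e ℚ.* ν l l#0 ℚ.≤ ν (coef i) p) → SteepestSlope (suc k)
        replace smaller = record
          { scale = l ; scale#0 = l#0 ; attainedAt = k ; gap = gap ; gap≡ = gap≡ ; attained = attained
          ; minimal = split-< smaller (λ e k+e≡n p → ℚ.≤-reflexive (slope e k+e≡n p)) }
        compare : (∀ i → i ℕ.< k → coef i ≈ 0#) ⊎ SteepestSlope k →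
                  (∀ i → i ℕ.< suc k → coef i ≈ 0#) ⊎ SteepestSlope (suc k)
        compare (inj₁ zeros) = inj₂ (replace λ i i<k e _ p → ⊥-elim (#⇒≉ p (zeros i i<k)))
        compare (inj₂ s) with ℚ.≤-total (ν l l#0) (ν (SteepestSlope.scale s) (SteepestSlope.scale#0 s))
        ... | inj₁ l≤s = inj₂ (replace λ i i<k e i+e≡n p →
                ℚ.≤-trans (mono-slope e l≤s) (SteepestSlope.minimal s i i<k e i+e≡n p))
        ... | inj₂ s≤l = inj₂ record
                { SteepestSlope s
                ; minimal = split-< (SteepestSlope.minimal s) (λ e k+e≡n p →
                    ℚ.≤-trans (mono-slope e s≤l) (ℚ.≤-reflexive (slope e k+e≡n p))) }

    -- The line through the origin of slope -σ passes through (n , ν bₙ) and has no point (i , ν bᵢ)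
    -- below it.
    IsLowerSlope : ℚ → Set c
    IsLowerSlope σ = (∀ i (p : coef i # 0#) → 0ℚ ℚ.≤ ν (coef i) p ℚ.+ ℕ→ℚ i ℚ.* σ) ×
                     ν-bₙ ℚ.+ ℕ→ℚ n ℚ.* σ ≡ 0ℚ

    -- With no lower coefficient there is no slope to minimise and no condition besides the one at
    -- n, so an n-th root of 1 / bₙ serves as the scale.
    lower-slope-of-monomial : (∀ i → i ℕ.< n → coef i ≈ 0#) → ∃[ σ ] IsLowerSlope σ
    lower-slope-of-monomial zeros = ν l l#0 , above , total
      where
      l = proj₁ (ratio-root n′ 1#0)
      l#0 = proj₁ (proj₂ (ratio-root n′ 1#0))
      total : ν-bₙ ℚ.+ ℕ→ℚ n ℚ.* ν l l#0 ≡ 0ℚ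
      total = ≡.trans (ν-ratio l#0 n 1#0 (proj₂ (proj₂ (ratio-root n′ 1#0)))) (ν-1 1#0)
      above : ∀ i (p : coef i # 0#) → 0ℚ ℚ.≤ ν (coef i) p ℚ.+ ℕ→ℚ i ℚ.* ν l l#0
      above i p with ℕ.<-cmp i n
      ... | tri< i<n _ _    = ⊥-elim (#⇒≉ p (zeros i i<n))
      ... | tri≈ _ ≡.refl _ = ℚ.≤-reflexive (≡.sym (≡.trans (≡.cong (ℚ._+ ℕ→ℚ n ℚ.* ν l l#0) (ν-irr p bₙ#0)) total))
      ... | tri> _ _ n<i    = ⊥-elim (#⇒≉ p (b>≈0 i n<i))

    lower-slope-of-steepest : SteepestSlope n → ∃[ σ ] IsLowerSlope σ
    lower-slope-of-steepest s = ν l l#0 , above , total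
      where
      open SteepestSlope s renaming (scale to l; scale#0 to l#0)
      lⁿbₙ#0 = x#0y#0→xy#0 (^-#0 l#0 n) bₙ#0
      u = proj₁ (#0⇒invertible lⁿbₙ#0)
      leading≈1 : u * (l ^ n * coef n) ≈ 1#
      leading≈1 = trans (*-comm u _) (proj₂ (#0⇒invertible lⁿbₙ#0))
      u#0 = x*y#0⇒x#0 (x≈1⇒x#0 leading≈1)

      ν-term : ∀ i (p : coef i # 0#) (q : u * (l ^ i * coef i) # 0#) →
        ν (u * (l ^ i * coef i)) q ≡ ν u u#0 ℚ.+ (ν (coef i) p ℚ.+ ℕ→ℚ i ℚ.* ν l l#0)
      ν-term i p q = ≡.trans (ν-* u#0 lᵢbᵢ#0 q) (≡.cong (ν u u#0 ℚ.+_)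
        (≡.trans (ν-* (^-#0 l#0 i) p lᵢbᵢ#0)
          (≡.trans (ℚ.+-comm _ (ν (coef i) p)) (≡.cong (ν (coef i) p ℚ.+_) (ν-^ l#0 i (^-#0 l#0 i))))))
        where lᵢbᵢ#0 = x#0y#0→xy#0 (^-#0 l#0 i) p

      balance : ν u u#0 ℚ.+ (ν-bₙ ℚ.+ ℕ→ℚ n ℚ.* ν l l#0) ≡ 0ℚ
      balance = ≡.trans (≡.sym (ν-term n bₙ#0 (x≈1⇒x#0 leading≈1))) (ν-≈1 _ leading≈1)

      integral-below : ∀ i → i ℕ.< n → Integral (u * (l ^ i * coef i))
      integral-below i i<n q = begin
        0ℚ
          ≡⟨ balance ⟨
        ν u u#0 ℚ.+ (ν-bₙ ℚ.+ ℕ→ℚ n ℚ.* ν l l#0)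
          -- Splitting n as i + e isolates ν bₙ + e ν l, the quantity that `minimal` bounds by ν bᵢ.
          ≡⟨ ≡.cong (λ x → ν u u#0 ℚ.+ (ν-bₙ ℚ.+ x ℚ.* ν l l#0))
               (≡.trans (≡.cong ℕ→ℚ (≡.sym i+e≡n)) (ℕ→ℚ-+ i e)) ⟩
        ν u u#0 ℚ.+ (ν-bₙ ℚ.+ (ℕ→ℚ i ℚ.+ ℕ→ℚ e) ℚ.* ν l l#0)
          ≡⟨ regroup (ν u u#0) ν-bₙ (ℕ→ℚ i) (ℕ→ℚ e) (ν l l#0) ⟩
        ν u u#0 ℚ.+ ((ν-bₙ ℚ.+ ℕ→ℚ e ℚ.* ν l l#0) ℚ.+ ℕ→ℚ i ℚ.* ν l l#0)
          ≤⟨ ℚ.+-monoʳ-≤ (ν u u#0) (ℚ.+-monoˡ-≤ (ℕ→ℚ i ℚ.* ν l l#0) (minimal i i<n e i+e≡n bᵢ#0)) ⟩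
        ν u u#0 ℚ.+ (ν (coef i) bᵢ#0 ℚ.+ ℕ→ℚ i ℚ.* ν l l#0)
          ≡⟨ ν-term i bᵢ#0 q ⟨
        ν (u * (l ^ i * coef i)) q ∎
        where
        open ℚ.≤-Reasoning
        bᵢ#0 = x*y#0⇒y#0 (x*y#0⇒y#0 q)
        e = n ℕ.∸ i
        i+e≡n : i ℕ.+ e ≡ n
        i+e≡n = ℕ.m+[n∸m]≡n (ℕ.<⇒≤ i<n)

      integral : ∀ i → Integral (u * (l ^ i * coef i))
      integral i = by-comparison (ℕ.<-cmp i n)
        where
        by-comparison : Tri (i ℕ.< n) (i ≡ n) (n ℕ.< i) → Integral (u * (l ^ i * coef i))
        by-comparison (tri< i<n _ _) = integral-below i i<n
        by-comparison (tri≈ _ i≡n _) = ≡.subst (λ i → Integral (u * (l ^ i * coef i))) (≡.sym i≡n)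
                                         (integral-cong (sym leading≈1) integral-1)
        by-comparison (tri> _ _ n<i) = integral-0 (trans (*-congˡ (trans (*-congˡ (b>≈0 i n<i)) (zeroʳ _))) (zeroʳ u))

      -- By the choice of l, the coefficient bⱼ equals lⁿ⁻ʲ bₙ, not just in valuation. So the
      -- rescaled polynomial has the same coefficient at j as at n, namely 1.
      jth≈1 : u * (l ^ attainedAt * coef attainedAt) ≈ 1#
      jth≈1 = begin
        u * (l ^ attainedAt * coef attainedAt)                ≈⟨ *-congˡ (*-congˡ attained) ⟨
        u * (l ^ attainedAt * (l ^ suc gap * coef n))         ≈⟨ *-congˡ (*-assoc _ _ _) ⟨
        u * (l ^ attainedAt * l ^ suc gap * coef n)           ≈⟨ *-congˡ (*-congʳ (^-homo-* l attainedAt (suc gap))) ⟨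
        u * (l ^ (attainedAt ℕ.+ suc gap) * coef n)           ≈⟨ *-congˡ (*-congʳ (^-congʳ l gap≡)) ⟩
        u * (l ^ n * coef n)                                  ≈⟨ leading≈1 ⟩
        1#                                                 ∎
        where open SetoidReasoning setoid
      j<n : attainedAt ℕ.< n
      j<n = ≡.subst (suc attainedAt ℕ.≤_) gap≡ (≡.subst (suc attainedAt ℕ.≤_) (≡.sym (ℕ.+-suc attainedAt gap))
              (s≤s (ℕ.m≤m+n attainedAt gap)))

      u-not-small : ¬ (Integral u → Small u)
      u-not-small = critical-value-not-small l u l#0 u#0 leading≈1 integral attainedAt j<n jth≈1

      νu≡0 : ν u u#0 ≡ 0ℚ
      νu≡0 = by-size (integral? u) (small? u)
        where
        -- If ν u < 0, then u is not integral and the implication refuted by `u-not-small` would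
        -- hold vacuously; if ν u > 0, its conclusion would hold.
        by-size : Integral u ⊎ (Σ[ p ∈ u # 0# ] ν u p ℚ.< 0ℚ) → Small u ⊎ (Σ[ p ∈ u # 0# ] ν u p ℚ.≤ 0ℚ) →
                  ν u u#0 ≡ 0ℚ
        by-size (inj₂ (p , νu<0)) _               =
          ⊥-elim (u-not-small λ int → ⊥-elim (ℚ.<-irrefl ≡.refl (ℚ.≤-<-trans (int p) νu<0)))
        by-size (inj₁ _)          (inj₁ s)          = ⊥-elim (u-not-small λ _ → s)
        by-size (inj₁ int)        (inj₂ (p , νu≤0)) = ℚ.≤-antisym (≡.subst (ℚ._≤ 0ℚ) (ν-irr p u#0) νu≤0) (int u#0)

      total : ν-bₙ ℚ.+ ℕ→ℚ n ℚ.* ν l l#0 ≡ 0ℚ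
      total = ≡.trans (≡.sym (ℚ.+-identityˡ _))
        (≡.trans (≡.cong (ℚ._+ (ν-bₙ ℚ.+ ℕ→ℚ n ℚ.* ν l l#0)) (≡.sym νu≡0)) balance)
      above : ∀ i (p : coef i # 0#) → 0ℚ ℚ.≤ ν (coef i) p ℚ.+ ℕ→ℚ i ℚ.* ν l l#0
      above i p = ≡.subst (0ℚ ℚ.≤_)
        (≡.trans (ν-term i p q) (≡.trans (≡.cong (ℚ._+ (ν (coef i) p ℚ.+ ℕ→ℚ i ℚ.* ν l l#0)) νu≡0) (ℚ.+-identityˡ _)))
        (integral i q)
        where q = x#0y#0→xy#0 u#0 (x#0y#0→xy#0 (^-#0 l#0 i) p)

    lower-slope : ∃[ σ ] IsLowerSlope σ
    lower-slope = [ lower-slope-of-monomial , lower-slope-of-steepest ]′ (steepest-slope n ℕ.≤-refl)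

-- Convex hulls and exposed points in the rational plane

0≤* : ∀ {p q} → 0ℚ ℚ.≤ p → 0ℚ ℚ.≤ q → 0ℚ ℚ.≤ p ℚ.* q
0≤* {p} {q} 0≤p 0≤q = ≡.subst (ℚ._≤ p ℚ.* q) (ℚ.*-zeroʳ p) (ℚ.*-monoˡ-≤-nonNeg p 0≤q)
  where instance _ = ℚ.nonNegative 0≤p

0<* : ∀ {p q} → 0ℚ ℚ.< p → 0ℚ ℚ.< q → 0ℚ ℚ.< p ℚ.* q
0<* {p} {q} 0<p 0<q = ≡.subst (ℚ._< p ℚ.* q) (ℚ.*-zeroʳ p) (ℚ.*-monoʳ-<-pos p 0<q)
  where instance _ = ℚ.positive 0<p

p≤q⇒0≤q-p : ∀ {p q} → p ℚ.≤ q → 0ℚ ℚ.≤ q ℚ.- p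
p≤q⇒0≤q-p {p} {q} p≤q = ≡.subst (ℚ._≤ q ℚ.- p) (ℚ.+-inverseʳ p) (ℚ.+-monoˡ-≤ (ℚ.- p) p≤q)

-- Strictly between 0 and 1 both weights are positive, so neither of the two nonnegative values can
-- be positive.
nonneg-combination≡0 : ∀ {t x y} → 0ℚ ℚ.≤ t → t ℚ.≤ 1ℚ → 0ℚ ℚ.≤ x → 0ℚ ℚ.≤ y →
  (1ℚ ℚ.- t) ℚ.* x ℚ.+ t ℚ.* y ≡ 0ℚ → t ≡ 0ℚ ⊎ t ≡ 1ℚ ⊎ (x ≡ 0ℚ × y ≡ 0ℚ)
nonneg-combination≡0 {t} {x} {y} 0≤t t≤1 0≤x 0≤y eq with ℚ.<-cmp 0ℚ t | ℚ.<-cmp t 1ℚ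
... | tri≈ _ 0≡t _ | _            = inj₁ (≡.sym 0≡t)
... | tri> _ _ t<0 | _            = ⊥-elim (ℚ.<-irrefl ≡.refl (ℚ.≤-<-trans 0≤t t<0))
... | tri< _ _ _   | tri≈ _ t≡1 _ = inj₂ (inj₁ t≡1)
... | tri< _ _ _   | tri> _ _ 1<t = ⊥-elim (ℚ.<-irrefl ≡.refl (ℚ.<-≤-trans 1<t t≤1))
... | tri< 0<t _ _ | tri< t<1 _ _ = inj₂ (inj₂ (≤⇒≡ x≤0 0≤x , ≤⇒≡ y≤0 0≤y))
  where
  ≤⇒≡ : ∀ {p} → (0ℚ ℚ.< p → ⊥) → 0ℚ ℚ.≤ p → p ≡ 0ℚ
  ≤⇒≡ p≯0 0≤p = ℚ.≤-antisym (ℚ.≮⇒≥ p≯0) 0≤p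
  0<1-t : 0ℚ ℚ.< 1ℚ ℚ.- t
  0<1-t = ≡.subst (ℚ._< 1ℚ ℚ.- t) (ℚ.+-inverseʳ t) (ℚ.+-monoˡ-< (ℚ.- t) t<1)
  x≤0 : 0ℚ ℚ.< x → ⊥
  x≤0 0<x = ℚ.<-irrefl (≡.sym eq) (ℚ.+-mono-<-≤ (0<* 0<1-t 0<x) (0≤* 0≤t 0≤y))
  y≤0 : 0ℚ ℚ.< y → ⊥
  y≤0 0<y = ℚ.<-irrefl (≡.sym eq) (ℚ.+-mono-≤-< (0≤* (ℚ.<⇒≤ 0<1-t) 0≤x) (0<* 0<t 0<y))

mix : ℚ → ℚ → ℚ → ℚ
mix t x y = (1ℚ ℚ.- t) ℚ.* x ℚ.+ t ℚ.* y

mixPoint : ℚ → Point → Point → Point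
mixPoint t u v = mix t (proj₁ u) (proj₁ v) , mix t (proj₂ u) (proj₂ v)

mixPoint-0 : ∀ {t} u v → t ≡ 0ℚ → mixPoint t u v ≡ u
mixPoint-0 u v t≡0 = ≡.trans (≡.cong (λ t → mixPoint t u v) t≡0)
  (≡.cong₂ _,_ (mix-0 (proj₁ u) (proj₁ v)) (mix-0 (proj₂ u) (proj₂ v)))
  where
  mix-0 : ∀ x y → mix 0ℚ x y ≡ x
  mix-0 = solve 2 (λ x y → (con 1ℚ :- con 0ℚ) :* x :+ con 0ℚ :* y := x) ≡.refl
    where open +-*-Solver

mixPoint-1 : ∀ {t} u v → t ≡ 1ℚ → mixPoint t u v ≡ v
mixPoint-1 u v t≡1 = ≡.trans (≡.cong (λ t → mixPoint t u v) t≡1)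
  (≡.cong₂ _,_ (mix-1 (proj₁ u) (proj₁ v)) (mix-1 (proj₂ u) (proj₂ v)))
  where
  mix-1 : ∀ x y → mix 1ℚ x y ≡ y
  mix-1 = solve 2 (λ x y → (con 1ℚ :- con 1ℚ) :* x :+ con 1ℚ :* y := y) ≡.refl
    where open +-*-Solver

mixPoint-same : ∀ t u → mixPoint t u u ≡ u
mixPoint-same t u = ≡.cong₂ _,_ (mix-same (proj₁ u)) (mix-same (proj₂ u))
  where
  mix-same : ∀ x → mix t x x ≡ x
  mix-same = solve 2 (λ t x → (con 1ℚ :- t) :* x :+ t :* x := x) ≡.refl t
    where open +-*-Solver

-- Affine forms as data: every bound on a hull used below says that such a form is nonnegative, so a
-- single induction over the hull proves them all.
record Affine : Set where
  constructor affine
  field α β γ : ℚ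

  infix 8 _$_
  _$_ : Point → ℚ
  _$_ (x , y) = α ℚ.* x ℚ.+ β ℚ.* y ℚ.+ γ
open Affine using (_$_)

affine-mix : ∀ φ t u v → φ $ mixPoint t u v ≡ mix t (φ $ u) (φ $ v)
affine-mix (affine α β γ) t (u₁ , u₂) (v₁ , v₂) = solve 8
  (λ α β γ t u₁ u₂ v₁ v₂ →
    α :* ((con 1ℚ :- t) :* u₁ :+ t :* v₁) :+ β :* ((con 1ℚ :- t) :* u₂ :+ t :* v₂) :+ γ :=
    (con 1ℚ :- t) :* (α :* u₁ :+ β :* u₂ :+ γ) :+ t :* (α :* v₁ :+ β :* v₂ :+ γ))
  ≡.refl α β γ t u₁ u₂ v₁ v₂
  where open +-*-Solver

module _ {S : Pred Point ℓ} where

  hull-nonneg : ∀ φ → (∀ w → S w → 0ℚ ℚ.≤ φ $ w) → ∀ w → ConvexHull S w → 0ℚ ℚ.≤ φ $ w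
  hull-nonneg φ 0≤ w (point w∈S) = 0≤ w w∈S
  hull-nonneg φ 0≤ _ (between {u} {v} u∈ v∈ (t , 0≤t , t≤1 , ≡.refl)) =
    ≡.subst (0ℚ ℚ.≤_) (≡.sym (affine-mix φ t u v))
      (ℚ.+-mono-≤ (0≤* (p≤q⇒0≤q-p t≤1) (hull-nonneg φ 0≤ u u∈)) (0≤* 0≤t (hull-nonneg φ 0≤ v v∈)))

  module _ (φ : Affine) (z : Point) (0≤ : ∀ w → S w → 0ℚ ℚ.≤ φ $ w) (only : ∀ w → S w → φ $ w ≡ 0ℚ → w ≡ z) where

    -- A point of the hull on the supporting line φ = 0 is an endpoint of the segment producing it,
    -- or both endpoints lie on that line. By induction the endpoints concerned are `z`.
    exposed : ∀ w → ConvexHull S w → φ $ w ≡ 0ℚ → w ≡ z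
    exposed w (point w∈S) φw≡0 = only w w∈S φw≡0
    exposed _ (between {u} {v} u∈ v∈ (t , 0≤t , t≤1 , ≡.refl)) φw≡0 =
      [ (λ t≡0 → let w≡u = mixPoint-0 u v t≡0 in
          ≡.trans w≡u (exposed u u∈ (≡.trans (≡.cong (φ $_) (≡.sym w≡u)) φw≡0)))
      , [ (λ t≡1 → let w≡v = mixPoint-1 u v t≡1 in
            ≡.trans w≡v (exposed v v∈ (≡.trans (≡.cong (φ $_) (≡.sym w≡v)) φw≡0)))
        , (λ (φu≡0 , φv≡0) → ≡.trans
            (≡.cong₂ (mixPoint t) (exposed u u∈ φu≡0) (exposed v v∈ φv≡0))
            (mixPoint-same t z)) ]′ ]′
      (nonneg-combination≡0 0≤t t≤1 (hull-nonneg φ 0≤ u u∈) (hull-nonneg φ 0≤ v v∈)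
        (≡.trans (≡.sym (affine-mix φ t u v)) φw≡0))

    -- Exposed points are extreme: were `z` strictly inside a segment of the hull, the whole segment
    -- would lie on the supporting line, which meets the hull only in `z`.
    exposed-vertex : ConvexHull S z → φ $ z ≡ 0ℚ → IsVertex (ConvexHull S) z
    exposed-vertex z∈ φz≡0 = z∈ , extreme
      where
      extreme : ∀ u v → ConvexHull S u → ConvexHull S v → Segment u v z → z ≡ u ⊎ z ≡ v
      extreme u v u∈ v∈ (t , 0≤t , t≤1 , z≡) =
        [ (λ t≡0 → inj₁ (≡.trans z≡ (mixPoint-0 u v t≡0)))
        , [ (λ t≡1 → inj₂ (≡.trans z≡ (mixPoint-1 u v t≡1)))
          , (λ (φu≡0 , _) → inj₁ (≡.sym (exposed u u∈ φu≡0))) ]′ ]′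
        (nonneg-combination≡0 0≤t t≤1 (hull-nonneg φ 0≤ u u∈) (hull-nonneg φ 0≤ v v∈)
          (≡.trans (≡.sym (affine-mix φ t u v)) (≡.trans (≡.cong (φ $_) (≡.sym z≡)) φz≡0)))

-- The cross product by which `CounterClockwise` is tested. Its vanishing on segments shows that a
-- hull with a point strictly above the bottom edge is no segment.
segment-collinear : ∀ a b {u v w} → Segment a b u → Segment a b v → Segment a b w →
  (proj₁ v ℚ.- proj₁ u) ℚ.* (proj₂ w ℚ.- proj₂ u) ℚ.- (proj₂ v ℚ.- proj₂ u) ℚ.* (proj₁ w ℚ.- proj₁ u) ≡ 0ℚ
segment-collinear (a₁ , a₂) (b₁ , b₂) (r , _ , _ , ≡.refl) (s , _ , _ , ≡.refl) (t , _ , _ , ≡.refl) = solve 7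
  (λ a₁ a₂ b₁ b₂ r s t → let m = λ t x y → (con 1ℚ :- t) :* x :+ t :* y in
    (m s a₁ b₁ :- m r a₁ b₁) :* (m t a₂ b₂ :- m r a₂ b₂) :- (m s a₂ b₂ :- m r a₂ b₂) :* (m t a₁ b₁ :- m r a₁ b₁) := con 0ℚ)
  ≡.refl a₁ a₂ b₁ b₂ r s t
  where open +-*-Solver

any-last : ∀ {P : Pred Point ℓ} xs → AnyMaybe P (last xs) → Any P xs
any-last (x ∷ [])     (just p) = here p
any-last (x ∷ y ∷ xs) p        = there (any-last (y ∷ xs) p)

-- When the lower boundary of a hull is a single edge

module LowerSegment {S : Pred Point ℓ} (N σ : ℚ) (0<N : 0ℚ ℚ.< N) where

  start end : Point
  start = 0ℚ , 0ℚ
  end = N , ℚ.- (N ℚ.* σ)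

  -- `height` measures how far a point is above the line through `start` and `end`; the other two, x
  -- and N - x, expose `start` and `end` as vertices.
  height abscissa coabscissa : Affine
  height     = affine σ 1ℚ 0ℚ
  abscissa   = affine 1ℚ 0ℚ 0ℚ
  coabscissa = affine (ℚ.- 1ℚ) 0ℚ N

  module _ (start∈S : S start) (end∈S : S end)
           (0≤height : ∀ w → S w → 0ℚ ℚ.≤ height $ w)
           (0≤abscissa : ∀ w → S w → 0ℚ ℚ.≤ proj₁ w)
           (abscissa≡0 : ∀ w → S w → proj₁ w ≡ 0ℚ → w ≡ start)
           (abscissa≤N : ∀ w → S w → proj₁ w ℚ.≤ N)
           (abscissa≡N : ∀ w → S w → proj₁ w ≡ N → w ≡ end)
           (flat? : (∀ w → S w → height $ w ≡ 0ℚ) ⊎ ∃[ w ] S w × 0ℚ ℚ.< height $ w) where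

    private
      C : Pred Point ℓ
      C = ConvexHull S

      abscissa≡ : ∀ w → abscissa $ w ≡ proj₁ w
      abscissa≡ (x , y) = solve 2 (λ x y → con 1ℚ :* x :+ con 0ℚ :* y :+ con 0ℚ := x) ≡.refl x y
        where open +-*-Solver

      coabscissa≡ : ∀ w → coabscissa $ w ≡ N ℚ.- proj₁ w
      coabscissa≡ (x , y) = solve 3 (λ x y n → (:- con 1ℚ) :* x :+ con 0ℚ :* y :+ n := n :- x) ≡.refl x y N
        where open +-*-Solver

      abscissa-nonneg : ∀ w → S w → 0ℚ ℚ.≤ abscissa $ w
      abscissa-nonneg w w∈S = ≡.subst (0ℚ ℚ.≤_) (≡.sym (abscissa≡ w)) (0≤abscissa w w∈S)

      abscissa-only : ∀ w → S w → abscissa $ w ≡ 0ℚ → w ≡ start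
      abscissa-only w w∈S eq = abscissa≡0 w w∈S (≡.trans (≡.sym (abscissa≡ w)) eq)

      coabscissa-nonneg : ∀ w → S w → 0ℚ ℚ.≤ coabscissa $ w
      coabscissa-nonneg w w∈S = ≡.subst (0ℚ ℚ.≤_) (≡.sym (coabscissa≡ w)) (p≤q⇒0≤q-p (abscissa≤N w w∈S))

      coabscissa-only : ∀ w → S w → coabscissa $ w ≡ 0ℚ → w ≡ end
      coabscissa-only w w∈S eq = abscissa≡N w w∈S
        (≡.sym (x∙y⁻¹≈ε⇒x≈y N (proj₁ w) (≡.trans (≡.sym (coabscissa≡ w)) eq)))
        where open GroupProperties (CommutativeRing.+-group ℚ.+-*-commutativeRing) using (x∙y⁻¹≈ε⇒x≈y)

      start∈C : C start
      start∈C = point start∈S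
      end∈C : C end
      end∈C = point end∈S

      start≢end : start ≢ end
      start≢end eq = ℚ.<-irrefl (≡.cong proj₁ eq) 0<N

      segment⊆C : ∀ {w} → Segment start end w → C w
      segment⊆C = between start∈C end∈C

      0≤x : ∀ w → C w → 0ℚ ℚ.≤ proj₁ w
      0≤x w w∈ = ≡.subst (0ℚ ℚ.≤_) (abscissa≡ w) (hull-nonneg abscissa abscissa-nonneg w w∈)

      x≤N : ∀ w → C w → proj₁ w ℚ.≤ N
      x≤N w w∈ = ≡.subst₂ ℚ._≤_ (ℚ.+-identityˡ _) (N-x+x N (proj₁ w)) (ℚ.+-monoˡ-≤ (proj₁ w)
        (≡.subst (0ℚ ℚ.≤_) (coabscissa≡ w) (hull-nonneg coabscissa coabscissa-nonneg w w∈)))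
        where
        N-x+x : ∀ n x → n ℚ.- x ℚ.+ x ≡ n
        N-x+x = solve 2 (λ n x → n :- x :+ x := n) ≡.refl
          where open +-*-Solver

      flat⊆segment : ∀ w → C w → height $ w ≡ 0ℚ → Segment start end w
      flat⊆segment w@(x , y) w∈ h≡0 = t , 0≤t , t≤1 , ≡.cong₂ _,_ x≡ y≡
        where
        instance
          _ = ℚ.positive 0<N
          _ = ℚ.pos⇒nonZero N
        1/N = ℚ.1/ N
        t = x ℚ.* 1/N
        0≤1/N : 0ℚ ℚ.≤ 1/N
        0≤1/N = ℚ.<⇒≤ (ℚ.positive⁻¹ 1/N {{ℚ.1/pos⇒pos N}})
        0≤t : 0ℚ ℚ.≤ t
        0≤t = 0≤* (0≤x w w∈) 0≤1/N
        t≤1 : t ℚ.≤ 1ℚ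
        t≤1 = ≡.subst (t ℚ.≤_) (ℚ.*-inverseʳ N) (ℚ.*-monoʳ-≤-nonNeg 1/N {{ℚ.nonNegative 0≤1/N}} (x≤N w w∈))
        tN≡x : t ℚ.* N ≡ x
        tN≡x = ≡.trans (ℚ.*-assoc x 1/N N) (≡.trans (≡.cong (x ℚ.*_) (ℚ.*-inverseˡ N)) (ℚ.*-identityʳ x))
        x≡ : x ≡ (1ℚ ℚ.- t) ℚ.* 0ℚ ℚ.+ t ℚ.* N
        x≡ = ≡.trans (≡.sym tN≡x) (solve 2 (λ t n → t :* n := (con 1ℚ :- t) :* con 0ℚ :+ t :* n) ≡.refl t N)
          where open +-*-Solver
        y≡ : y ≡ (1ℚ ℚ.- t) ℚ.* 0ℚ ℚ.+ t ℚ.* (ℚ.- (N ℚ.* σ))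
        y≡ = begin
          y
            ≡⟨ solve 3 (λ s x y → y := (s :* x :+ con 1ℚ :* y :+ con 0ℚ) :- x :* s) ≡.refl σ x y ⟩
          height $ w ℚ.- x ℚ.* σ
            ≡⟨ ≡.cong₂ (λ h x → h ℚ.- x ℚ.* σ) h≡0 (≡.sym tN≡x) ⟩
          0ℚ ℚ.- t ℚ.* N ℚ.* σ
            ≡⟨ solve 3 (λ t n s → con 0ℚ :- t :* n :* s := (con 1ℚ :- t) :* con 0ℚ :+ t :* (:- (n :* s))) ≡.refl t N σ ⟩
          (1ℚ ℚ.- t) ℚ.* 0ℚ ℚ.+ t ℚ.* (ℚ.- (N ℚ.* σ)) ∎
          where
          open ≡.≡-Reasoning
          open +-*-Solver

      start-only : ∀ w → C w → proj₁ w ℚ.≤ 0ℚ → w ≡ start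
      start-only w w∈ x≤0 = exposed abscissa start abscissa-nonneg abscissa-only w w∈
        (≡.trans (abscissa≡ w) (ℚ.≤-antisym x≤0 (0≤x w w∈)))

      end-only : ∀ w → C w → N ℚ.≤ proj₁ w → w ≡ end
      end-only w w∈ N≤x = exposed coabscissa end coabscissa-nonneg coabscissa-only w w∈
        (≡.trans (coabscissa≡ w) (≡.trans (≡.cong (λ x → N ℚ.- x) (ℚ.≤-antisym (x≤N w w∈) N≤x)) (ℚ.+-inverseʳ N)))

      start-vertex : IsVertex C start
      start-vertex = exposed-vertex abscissa start abscissa-nonneg abscissa-only start∈C (abscissa≡ start)

      end-vertex : IsVertex C end
      end-vertex = exposed-vertex coabscissa end coabscissa-nonneg coabscissa-only end∈C
        (≡.trans (coabscissa≡ end) (ℚ.+-inverseʳ N))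

      cross-above : ∀ w → (N ℚ.- 0ℚ) ℚ.* (proj₂ w ℚ.- 0ℚ) ℚ.- (ℚ.- (N ℚ.* σ) ℚ.- 0ℚ) ℚ.* (proj₁ w ℚ.- 0ℚ)
                          ≡ N ℚ.* (height $ w)
      cross-above (x , y) = solve 4 (λ n s x y →
          (n :- con 0ℚ) :* (y :- con 0ℚ) :- ((:- (n :* s)) :- con 0ℚ) :* (x :- con 0ℚ) :=
          n :* (s :* x :+ con 1ℚ :* y :+ con 0ℚ)) ≡.refl N σ x y
        where open +-*-Solver

      cross-end : ∀ w → (proj₁ w ℚ.- 0ℚ) ℚ.* (ℚ.- (N ℚ.* σ) ℚ.- 0ℚ) ℚ.- (proj₂ w ℚ.- 0ℚ) ℚ.* (N ℚ.- 0ℚ)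
                        ≡ ℚ.- (N ℚ.* (height $ w))
      cross-end (x , y) = solve 4 (λ n s x y →
          (x :- con 0ℚ) :* ((:- (n :* s)) :- con 0ℚ) :- (y :- con 0ℚ) :* (n :- con 0ℚ) :=
          :- (n :* (s :* x :+ con 1ℚ :* y :+ con 0ℚ))) ≡.refl N σ x y
        where open +-*-Solver

      -- Testing the edge from `start` to `w` against the point `end` gives height ≤ 0 at `w`. The
      -- hull has no negative heights, so `w` is on the bottom segment, and a vertex there is one of
      -- its endpoints.
      successor-of-start : ∀ w → IsVertex C w → start ≢ w → CounterClockwise C start w → w ≡ end
      successor-of-start w w-vertex@(w∈ , extreme) start≢w ccw =
        [ (λ w≡start → ⊥-elim (start≢w (≡.sym w≡start))) , (λ w≡end → w≡end) ]′
          (extreme start end start∈C end∈C (flat⊆segment w w∈ flat))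
        where
        flat : height $ w ≡ 0ℚ
        flat with ℚ.<-cmp 0ℚ (height $ w)
        ... | tri< 0<h _ _ = ⊥-elim (ℚ.<-irrefl ≡.refl (ℚ.<-≤-trans (ℚ.neg-antimono-< (0<* 0<N 0<h))
                (≡.subst (0ℚ ℚ.≤_) (cross-end w) (ccw end end∈C))))
        ... | tri≈ _ 0≡h _ = ≡.sym 0≡h
        ... | tri> _ _ h<0 = ⊥-elim (ℚ.<-irrefl ≡.refl (ℚ.≤-<-trans (hull-nonneg height 0≤height w w∈) h<0))

      first-edge : ∀ {v₁ v₂ vs} → IsLowerVertexList C (v₁ ∷ v₂ ∷ vs) → v₁ ≡ start × v₂ ≡ end
      first-edge {v₁} {v₂} {vs} list = go (IsLowerVertexList.vertices list) (IsLowerVertexList.distinct list)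
                                          (IsLowerVertexList.consecutive list) (IsLowerVertexList.starts list)
        where
        go : All (IsVertex C) (v₁ ∷ v₂ ∷ vs) → Unique (v₁ ∷ v₂ ∷ vs) → Linked (CounterClockwise C) (v₁ ∷ v₂ ∷ vs) →
             AnyMaybe (IsLeftmostVertex C) (Maybe.just v₁) → v₁ ≡ start × v₂ ≡ end
        go ((v₁∈ , _) ∷ v₂-vertex ∷ _) ((v₁≢v₂ ∷ _) ∷ _) (ccw ∷ _) (just (_ , leftmost)) =
          v₁≡start , successor-of-start v₂ v₂-vertex (λ start≡v₂ → v₁≢v₂ (≡.trans v₁≡start start≡v₂))
                       (≡.subst (λ v → CounterClockwise C v v₂) v₁≡start ccw)
          where
          v₁≡start : v₁ ≡ start
          v₁≡start = start-only v₁ v₁∈ (leftmost start start-vertex)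

      last≢end : ∀ {v₁ vs} → v₁ ≡ end → Unique (v₁ ∷ vs) → ¬ Any (IsRightmostVertex C) vs
      last≢end v₁≡end (v₁≢vs ∷ _) rightmost = All.lookupWith
        (λ { v₁≢v ((v∈ , _) , rightmost) → v₁≢v (≡.trans v₁≡end (≡.sym (end-only _ v∈ (rightmost end end-vertex)))) })
        v₁≢vs rightmost

      -- The leftmost vertex is `start`, and the only possible successor is `end`. The list has to
      -- finish at the rightmost vertex, again `end`, so a third entry would repeat it, contrary to
      -- distinctness.
      path⊆segment : ∀ vs → IsLowerVertexList C vs → ∀ {w} → Path vs w → Segment start end w
      path⊆segment (v₁ ∷ v₂ ∷ []) list {w} (here w∈) =
        ≡.subst₂ (λ u v → Segment u v w) (proj₁ (first-edge list)) (proj₂ (first-edge list)) w∈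
      path⊆segment (v₁ ∷ v₂ ∷ []) list (there (there ()))
      path⊆segment (v₁ ∷ v₂ ∷ v₃ ∷ vs) list path = ⊥-elim
        (last≢end (proj₂ (first-edge list)) (AllPairs.tail (IsLowerVertexList.distinct list))
          (any-last (v₃ ∷ vs) (IsLowerVertexList.ends list)))
      path⊆segment (v₁ ∷ []) list (there ())

      edge : IsLowerVertexList C (start ∷ end ∷ [])
      edge = record
        { vertices    = start-vertex ∷ end-vertex ∷ []
        ; distinct    = (start≢end ∷ []) ∷ [] ∷ []
        ; consecutive = (λ w w∈ → ≡.subst (0ℚ ℚ.≤_) (≡.sym (cross-above w))
                          (0≤* (ℚ.<⇒≤ 0<N) (hull-nonneg height 0≤height w w∈))) ∷ [-]
        ; starts      = just (start-vertex , λ w w-vertex → 0≤x w (proj₁ w-vertex))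
        ; ends        = just (end-vertex , λ w w-vertex → x≤N w (proj₁ w-vertex)) }

      negated-height : ∀ w → affine (ℚ.- σ) (ℚ.- 1ℚ) 0ℚ $ w ≡ ℚ.- (height $ w)
      negated-height (x , y) = solve 3 (λ s x y →
          (:- s) :* x :+ (:- con 1ℚ) :* y :+ con 0ℚ := :- (s :* x :+ con 1ℚ :* y :+ con 0ℚ)) ≡.refl σ x y
        where open +-*-Solver

      flat-hull : (∀ w → S w → height $ w ≡ 0ℚ) → ∀ w → C w → height $ w ≡ 0ℚ
      flat-hull flat w w∈ = ℚ.≤-antisym
        (≡.subst₂ ℚ._≤_ (ℚ.+-identityʳ (height $ w)) (ℚ.+-inverseʳ (height $ w))
          (ℚ.+-monoʳ-≤ (height $ w) (≡.subst (0ℚ ℚ.≤_) (negated-height w)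
            (hull-nonneg (affine (ℚ.- σ) (ℚ.- 1ℚ) 0ℚ)
              (λ w w∈S → ℚ.≤-reflexive (≡.sym (≡.trans (negated-height w) (≡.cong ℚ.-_ (flat w w∈S))))) w w∈))))
        (hull-nonneg height 0≤height w w∈)

      not-degenerate : (∃[ w ] S w × 0ℚ ℚ.< height $ w) → ¬ (IsPoint C ⊎ IsLineSegment C)
      not-degenerate _ (inj₁ (z , C⊆z , _)) = start≢end (≡.trans (≡.sym (C⊆z start∈C)) (C⊆z end∈C))
      not-degenerate (w , w∈S , 0<h) (inj₂ (a , b , _ , C⊆ab , _)) = ℚ.<-irrefl
        (≡.trans (≡.sym (segment-collinear a b (C⊆ab start∈C) (C⊆ab end∈C) (C⊆ab (point w∈S)))) (cross-above w))
        (0<* 0<N 0<h)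

    -- `flat?` decides which clause of `LowerBoundary` applies. If all heights vanish, the hull
    -- itself is the segment; otherwise it is two-dimensional and its lower vertices are `start` and
    -- `end`.
    lowerBoundary-isLineSegment : IsLineSegment (LowerBoundary C)
    lowerBoundary-isLineSegment = start , end , start≢end , by-shape flat?
      where
      by-shape : (∀ w → S w → height $ w ≡ 0ℚ) ⊎ (∃[ w ] S w × 0ℚ ℚ.< height $ w) → LowerBoundary C ≐ Segment start end
      by-shape (inj₁ flat) = (λ { (inj₁ (_ , w∈)) → C⊆segment w∈
                                ; (inj₂ (not-segment , _)) → ⊥-elim (not-segment (inj₂ C-segment)) })
                           , (λ w∈ → inj₁ (inj₂ C-segment , segment⊆C w∈))
        where
        C⊆segment : ∀ {w} → C w → Segment start end w
        C⊆segment w∈ = flat⊆segment _ w∈ (flat-hull flat _ w∈)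
        C-segment : IsLineSegment C
        C-segment = start , end , start≢end , C⊆segment , segment⊆C
      by-shape (inj₂ high) = (λ { (inj₁ (degenerate , _)) → ⊥-elim (not-degenerate high degenerate)
                                ; (inj₂ (_ , vs , list , path)) → path⊆segment vs list path })
                           , (λ w∈ → inj₂ (not-degenerate high , start ∷ end ∷ [] , edge , here w∈))

-- Field embeddings and decidability of zero over ℚ

module EmbeddingProperties {K : HeytingField a b c} {L : HeytingField a′ b′ c′} (ι : Embedding K L) where
  private
    module K = HeytingFieldProperties K
    module L = HeytingFieldProperties L
    module K· = SemiringMult K.semiring
    module L· = SemiringMult L.semiring
  open Embedding ι public using (⟦_⟧)
  open RingMorphisms.IsRingHomomorphism (Embedding.isRingHomomorphism ι) public
    using (⟦⟧-cong; +-homo; *-homo; 0#-homo; 1#-homo; -‿homo)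

  -- A ring homomorphism comes with compatibility with equality only. Apartness from zero is carried
  -- over as invertibility.
  ⟦⟧-#0 : ∀ {x} → x K.# K.0# → ⟦ x ⟧ L.# L.0#
  ⟦⟧-#0 x#0 = let y , xy≈1 = K.#0⇒invertible x#0 in
    L.x*y≈1⇒x#0 (L.trans (L.sym (*-homo _ y)) (L.trans (⟦⟧-cong xy≈1) 1#-homo))

  ·1-homo : ∀ n → ⟦ n K·.× K.1# ⟧ L.≈ n L·.× L.1#
  ·1-homo zero    = 0#-homo
  ·1-homo (suc n) = L.trans (+-homo _ _) (L.+-cong 1#-homo (·1-homo n))

  coeff-mapPoly : ∀ f i → Polynomial.coeff L (mapPoly ι f) i L.≈ ⟦ Polynomial.coeff K f i ⟧
  coeff-mapPoly []      i       = L.sym 0#-homo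
  coeff-mapPoly (_ ∷ f) zero    = L.refl
  coeff-mapPoly (_ ∷ f) (suc i) = coeff-mapPoly f i

  -- Gives ℚ̄, where zero is decidable, the valuation of ℚ̄ₚ.
  restrict : Valuation L → Valuation K
  restrict V = record
    { ν      = λ x x#0 → Valuation.ν V ⟦ x ⟧ (⟦⟧-#0 x#0)
    ; ν-cong = λ _ _ x≈y → Valuation.ν-cong V _ _ (⟦⟧-cong x≈y)
    ; ν-*    = λ x#0 y#0 xy#0 → ≡.trans
        (Valuation.ν-cong V _ (L.#-congʳ (*-homo _ _) (⟦⟧-#0 xy#0)) (*-homo _ _))
        (Valuation.ν-* V (⟦⟧-#0 x#0) (⟦⟧-#0 y#0) _)
    ; ν-+    = λ x#0 y#0 x+y#0 → ℚ.≤-trans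
        (Valuation.ν-+ V (⟦⟧-#0 x#0) (⟦⟧-#0 y#0) (L.#-congʳ (+-homo _ _) (⟦⟧-#0 x+y#0)))
        (ℚ.≤-reflexive (≡.sym (Valuation.ν-cong V _ _ (+-homo _ _)))) }

-- Let f(x) = xᵐ g(x) = 0 with g(0) ≠ 0.  By cotransitivity either g(0) # g(x),
-- and then x # 0 as x divides g(x) - g(0), or g(x) # 0, and then xᵐ = 0.
module AlgebraicOverℚ {L : HeytingField a b c} (ι : Embedding ℚ.heytingField L) where
  open HeytingFieldProperties L
  open EmbeddingProperties ι
  open Polynomial L using (IsRoot; eval)
  private module ℚₓ = Polynomial ℚ.heytingField

  root⇒0⊎#0 : ∀ f x i → ℚₓ.coeff f i ≢ 0ℚ → (IsRoot (mapPoly ι f) x → x ≈ 0#) ⊎ x # 0#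
  root⇒0⊎#0 []      x i       ≢0 = ⊥-elim (≢0 ≡.refl)
  root⇒0⊎#0 (k ∷ f) x i       ≢0 with k ℚ.≟ 0ℚ
  root⇒0⊎#0 (k ∷ f) x zero    ≢0 | yes k≡0 = ⊥-elim (≢0 k≡0)
  root⇒0⊎#0 (k ∷ f) x (suc i) ≢0 | yes k≡0 = [ (λ rest → inj₁ (from-rest rest)) , inj₂ ]′ (root⇒0⊎#0 f x i ≢0)
    where
    e = eval (mapPoly ι f) x
    from-rest : (e ≈ 0# → x ≈ 0#) → ⟦ k ⟧ + x * e ≈ 0# → x ≈ 0#
    from-rest rest root = proj₁ (tight x 0#) λ x#0 → #-irrefl (rest (#0-cancelˡ x#0 xe≈0)) x#0
      where
      xe≈0 : x * e ≈ 0#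
      xe≈0 = trans (sym (trans (+-congʳ (trans (⟦⟧-cong k≡0) 0#-homo)) (+-identityˡ _))) root
  root⇒0⊎#0 (k ∷ f) x i       ≢0 | no k≢0 =
    [ (λ k#value → inj₂ (x-invertible (#⇒invertible k#value)))
    , (λ value#0 → inj₁ λ root → ⊥-elim (#-irrefl root value#0)) ]′ (#-cotrans (⟦⟧-#0 k≢0) (⟦ k ⟧ + x * e))
    where
    open SetoidReasoning setoid
    open AbelianGroupProperties +-abelianGroup using (⁻¹-∙-comm)
    e = eval (mapPoly ι f) x
    x-invertible : ∃[ y ] (y * (⟦ k ⟧ - (⟦ k ⟧ + x * e)) ≈ 1# × (⟦ k ⟧ - (⟦ k ⟧ + x * e)) * y ≈ 1#) → x # 0#
    x-invertible (y , _ , eq) = x*y≈1⇒x#0 {x} { - e * y} (begin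
      x * (- e * y)                          ≈⟨ *-assoc x (- e) y ⟨
      x * - e * y                            ≈⟨ *-congʳ (-‿distribʳ-* x e) ⟨
      - (x * e) * y                          ≈⟨ *-congʳ (+-identityˡ _) ⟨
      (0# - x * e) * y                       ≈⟨ *-congʳ (+-congʳ (-‿inverseʳ ⟦ k ⟧)) ⟨
      (⟦ k ⟧ - ⟦ k ⟧ - x * e) * y            ≈⟨ *-congʳ (+-assoc _ _ _) ⟩
      (⟦ k ⟧ + (- ⟦ k ⟧ - x * e)) * y        ≈⟨ *-congʳ (+-congˡ (⁻¹-∙-comm ⟦ k ⟧ (x * e))) ⟩
      (⟦ k ⟧ - (⟦ k ⟧ + x * e)) * y          ≈⟨ eq ⟩
      1#                                     ∎)

  closure-zero? : IsAlgebraicClosure ι → ∀ x → x ≈ 0# ⊎ x # 0#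
  closure-zero? closure x =
    let f , n , (leading≢0 , _) , root = IsAlgebraicClosure.algebraic closure x
    in [ (λ zero → inj₁ (zero root)) , inj₂ ]′ (root⇒0⊎#0 f x n leading≢0)

-- Valuations of the integers below p

private
  module ℚ· = SemiringMult (CommutativeRing.semiring ℚ.+-*-commutativeRing)

-- Equal to `ℕ→ℚ m`, but with a numerator and a denominator that reduce for a variable `m`, as is
-- wanted when applying `isPAdicValuation`.
integer : ℕ → ℚ
integer m = mkℚ (+ m) 0 (Coprimality.sym (1-coprimeTo m))

integer≡·1 : ∀ m → integer m ≡ m ℚ·.× 1ℚ
integer≡·1 m = ≡.trans (≡.sym (ℚ.normalize-coprime (Coprimality.sym (1-coprimeTo m)))) (ℕ→ℚ≡·1 m)
  where
  ℕ→ℚ≡·1 : ∀ m → ℕ→ℚ m ≡ m ℚ·.× 1ℚ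
  ℕ→ℚ≡·1 zero    = ≡.refl
  ℕ→ℚ≡·1 (suc m) = ≡.trans (ℕ→ℚ-+ 1 m) (≡.cong (1ℚ ℚ.+_) (ℕ→ℚ≡·1 m))

module _ {p : ℕ} (S : PAdicSetting p a b c) where
  open PAdicSetting S
  private
    module ℚ̄f = HeytingFieldProperties ℚ̄
    module ℚ̄ₚf = HeytingFieldProperties ℚ̄ₚ
    module ι = EmbeddingProperties ℚ̄→ℚ̄ₚ
    module j = EmbeddingProperties ℚ→ℚₚ
    module κ = EmbeddingProperties ℚₚ→ℚ̄ₚ
    module ℚ̄· = SemiringMult ℚ̄f.semiring
    module ℚ̄ₚ· = SemiringMult ℚ̄ₚf.semiring

  ν-ℚ̄ : Valuation ℚ̄
  ν-ℚ̄ = ι.restrict νₚ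

  ·1-#0 : ∀ k → suc k ℚ̄·.× ℚ̄f.1# ℚ̄f.# ℚ̄f.0#
  ·1-#0 k = ℚ̄f.#-congʳ (ℚ̄f.trans (ιℚ.⟦⟧-cong (integer≡·1 (suc k))) (ιℚ.·1-homo (suc k))) (ιℚ.⟦⟧-#0 {integer (suc k)} λ ())
    where module ιℚ = EmbeddingProperties ℚ→ℚ̄

  -- A positive integer below p is prime to p, and so is its denominator 1; hence both exponents are
  -- 0. The routes from ℚ to ℚ̄ₚ through ℚ̄ and through ℚₚ agree on it, because homomorphisms
  -- preserve multiples of 1.
  ν-·1 : ∀ k → suc k ℕ.< p → ν-ℚ̄ .Valuation.ν (suc k ℚ̄·.× ℚ̄f.1#) (·1-#0 k) ≡ 0ℚ
  ν-·1 k m<p = begin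
    νₚ .Valuation.ν (ι.⟦ suc k ℚ̄·.× ℚ̄f.1# ⟧) (ι.⟦⟧-#0 (·1-#0 k))
      ≡⟨ Valuation.ν-cong νₚ _ κjm#0 same ⟩
    νₚ .Valuation.ν (κ.⟦ j.⟦ integer (suc k) ⟧ ⟧) κjm#0
      ≡⟨ νₚ-extends (j.⟦ integer (suc k) ⟧) jm#0 κjm#0 ⟩
    ν-ℚₚ .Valuation.ν (j.⟦ integer (suc k) ⟧) jm#0
      ≡⟨ IsCompletion.extends isCompletion (integer (suc k)) m≢0 jm#0 ⟩
    ν-ℚ .Valuation.ν (integer (suc k)) m≢0
      ≡⟨ isPAdicValuation (integer (suc k)) m≢0 0 0
           (1∣ _ , p^1∤ (suc k) m<p) (1∣ _ , p^1∤ 1 (ℕ.≤-<-trans (s≤s z≤n) m<p)) ⟩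
    0ℚ ∎
    where
    open ≡.≡-Reasoning
    m≢0 : integer (suc k) ≢ 0ℚ
    m≢0 ()
    jm#0 = j.⟦⟧-#0 {integer (suc k)} m≢0
    κjm#0 = κ.⟦⟧-#0 jm#0
    p^1∤ : ∀ m .{{_ : ℕ.NonZero m}} → m ℕ.< p → p ℕ.^ 1 ∤ m
    p^1∤ m m<p = ≡.subst (_∤ m) (≡.sym (ℕ.*-identityʳ p)) (>⇒∤ m<p)
    same : ι.⟦ suc k ℚ̄·.× ℚ̄f.1# ⟧ ℚ̄ₚf.≈ κ.⟦ j.⟦ integer (suc k) ⟧ ⟧
    same = ℚ̄ₚf.trans (ι.·1-homo (suc k)) (ℚ̄ₚf.sym (ℚ̄ₚf.trans
      (κ.⟦⟧-cong (HeytingField.trans ℚₚ (j.⟦⟧-cong (integer≡·1 (suc k))) (j.·1-homo (suc k))))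
      (κ.·1-homo (suc k))))

-- The Newton polygon of B - 1

module _ {p : ℕ} (S : PAdicSetting p a b c) where
  open PAdicSetting S
  open HeytingField ℚ̄ using (1#; 0#; -_; _#_; _≈_; _+_)
  open Polynomial ℚ̄
  private
    module ℚ̄ = HeytingFieldProperties ℚ̄
    module ℚ̄ₚ = HeytingFieldProperties ℚ̄ₚ
    module ι = EmbeddingProperties ℚ̄→ℚ̄ₚ

    zero? : HasDecidableZero ℚ̄
    zero? = AlgebraicOverℚ.closure-zero? ℚ→ℚ̄ ℚ̄-closure
    closed = IsAlgebraicClosure.closed ℚ̄-closure
    module ν-ℚ̄ = Valuation (ν-ℚ̄ S)
    module V = ValuedField ℚ̄ (ν-ℚ̄ S) zero?
    open AlgebraicallyClosed ℚ̄ (ν-ℚ̄ S) zero? closed using (module Kₓ; coeff≡coefficient)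
    open CriticalValues ℚ̄ (ν-ℚ̄ S) zero? closed using (lower-slope)

  coeff-+ᵖ : ∀ f g i → coeff (f +ᵖ g) i ≈ coeff f i + coeff g i
  coeff-+ᵖ []      g       i       = ℚ̄.sym (ℚ̄.+-identityˡ _)
  coeff-+ᵖ (k ∷ f) []      i       = ℚ̄.sym (ℚ̄.+-identityʳ _)
  coeff-+ᵖ (k ∷ f) (l ∷ g) zero    = ℚ̄.refl
  coeff-+ᵖ (k ∷ f) (l ∷ g) (suc i) = coeff-+ᵖ f g i

  coeff-0 : ∀ f → eval f 0# ≈ 0# → coeff f 0 ≈ 0#
  coeff-0 []      _    = ℚ̄.refl
  coeff-0 (k ∷ f) root = ℚ̄.trans (ℚ̄.sym (ℚ̄.trans (ℚ̄.+-congˡ (ℚ̄.zeroˡ _)) (ℚ̄.+-identityʳ k))) root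

  module _ (B : Poly) (n′ : ℕ) (belyi : IsBelyi B) (degree : HasDegree B (suc n′)) (n<p : suc n′ ℕ.< p)
           (root : eval B 0# ≈ 0#) where
    private
      n : ℕ
      n = suc n′

      b-coefficient : ℕ → ℚ̄.Carrier
      b-coefficient = Kₓ.coefficient B

      coefficient≈ : ∀ i → b-coefficient i ≈ coeff B i
      coefficient≈ i = ℚ̄.reflexive (≡.sym (coeff≡coefficient B i))

      bₙ#0 : b-coefficient n # 0#
      bₙ#0 = ℚ̄.#-congʳ (ℚ̄.sym (coefficient≈ n)) (proj₁ degree)
      b₀≈0 : b-coefficient 0 ≈ 0#
      b₀≈0 = ℚ̄.trans (coefficient≈ 0) (coeff-0 B root)
      b>≈0 : ∀ i → n ℕ.< i → b-coefficient i ≈ 0#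
      b>≈0 i n<i = ℚ̄.trans (coefficient≈ i) (proj₂ degree i n<i)

      slope : ∃[ σ ] (∀ i (q : b-coefficient i # 0#) → 0ℚ ℚ.≤ ν-ℚ̄.ν (b-coefficient i) q ℚ.+ ℕ→ℚ i ℚ.* σ) ×
                     ν-ℚ̄.ν (b-coefficient n) bₙ#0 ℚ.+ ℕ→ℚ n ℚ.* σ ≡ 0ℚ
      slope = lower-slope B n′ (λ k k<n → ·1-#0 S k , ν-·1 S k (ℕ.≤-<-trans k<n n<p))
                bₙ#0 b₀≈0 b>≈0 (IsBelyi.criticalValues belyi)

      σ : ℚ
      σ = proj₁ slope

      F : Polynomial.Poly ℚ̄ₚ
      F = mapPoly ℚ̄→ℚ̄ₚ (B +ᵖ const (- 1#))

      f : ℕ → ℚ̄ₚ.Carrier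
      f = Polynomial.coeff ℚ̄ₚ F

      f≈ : ∀ i → f i ℚ̄ₚ.≈ ι.⟦ coeff B i + coeff (const (- 1#)) i ⟧
      f≈ i = ℚ̄ₚ.trans (ι.coeff-mapPoly (B +ᵖ const (- 1#)) i) (ι.⟦⟧-cong (coeff-+ᵖ B (const (- 1#)) i))

      -- As B has no constant term, subtracting 1 adds the point (0 , 0), the left end of the
      -- segment, and leaves all other points in place.
      f₀≈ : f 0 ℚ̄ₚ.≈ ι.⟦ - 1# ⟧
      f₀≈ = ℚ̄ₚ.trans (f≈ 0) (ι.⟦⟧-cong (ℚ̄.trans (ℚ̄.+-congʳ (coeff-0 B root)) (ℚ̄.+-identityˡ _)))

      f₁₊≈ : ∀ i → f (suc i) ℚ̄ₚ.≈ ι.⟦ b-coefficient (suc i) ⟧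
      f₁₊≈ i = ℚ̄ₚ.trans (f≈ (suc i))
        (ι.⟦⟧-cong (ℚ̄.trans (ℚ̄.+-identityʳ _) (ℚ̄.sym (coefficient≈ (suc i)))))

      f₀#0 : f 0 ℚ̄ₚ.# ℚ̄ₚ.0#
      f₀#0 = ℚ̄ₚ.#-congʳ (ℚ̄ₚ.sym f₀≈) (ι.⟦⟧-#0 ℚ̄.-1#0)

      f₁₊#0 : ∀ i → b-coefficient (suc i) # 0# → f (suc i) ℚ̄ₚ.# ℚ̄ₚ.0#
      f₁₊#0 i q = ℚ̄ₚ.#-congʳ (ℚ̄ₚ.sym (f₁₊≈ i)) (ι.⟦⟧-#0 q)

      b≈0⇒f≈0 : ∀ i → b-coefficient (suc i) ≈ 0# → f (suc i) ℚ̄ₚ.≈ ℚ̄ₚ.0#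
      b≈0⇒f≈0 i b≈0 = ℚ̄ₚ.trans (f₁₊≈ i) (ℚ̄ₚ.trans (ι.⟦⟧-cong b≈0) ι.0#-homo)

      f#0⇒b#0 : ∀ i → f (suc i) ℚ̄ₚ.# ℚ̄ₚ.0# → b-coefficient (suc i) # 0#
      f#0⇒b#0 i q = [ (λ b≈0 → ⊥-elim (ℚ̄ₚ.#-irrefl (b≈0⇒f≈0 i b≈0) q)) , (λ b#0 → b#0) ]′
        (zero? (b-coefficient (suc i)))

      f-zero? : ∀ i → f i ℚ̄ₚ.≈ ℚ̄ₚ.0# ⊎ f i ℚ̄ₚ.# ℚ̄ₚ.0#
      f-zero? zero    = inj₂ f₀#0
      f-zero? (suc i) = [ (λ b≈0 → inj₁ (b≈0⇒f≈0 i b≈0)) , (λ b#0 → inj₂ (f₁₊#0 i b#0)) ]′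
        (zero? (b-coefficient (suc i)))

      νf : ∀ i → f i ℚ̄ₚ.# ℚ̄ₚ.0# → ℚ
      νf i = Valuation.ν νₚ (f i)

      νf₀ : ∀ q → νf 0 q ≡ 0ℚ
      νf₀ q = ≡.trans (Valuation.ν-cong νₚ q (ι.⟦⟧-#0 ℚ̄.-1#0) f₀≈) (V.ν--1 ℚ̄.-1#0)

      νf₁₊ : ∀ i q r → νf (suc i) q ≡ ν-ℚ̄.ν (b-coefficient (suc i)) r
      νf₁₊ i q r = Valuation.ν-cong νₚ q (ι.⟦⟧-#0 r) (f₁₊≈ i)

      index≤n : ∀ i → f i ℚ̄ₚ.# ℚ̄ₚ.0# → i ℕ.≤ n
      index≤n zero    q = z≤n
      index≤n (suc i) q = ℕ.≮⇒≥ λ n<i → ℚ̄ₚ.#-irrefl (b≈0⇒f≈0 i (b>≈0 (suc i) n<i)) q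

      open LowerSegment {S = CoefficientPoint νₚ F} (ℕ→ℚ n) σ (ℕ→ℚ-mono-< {0} {n} (s≤s z≤n))
        using (start; end; height; lowerBoundary-isLineSegment)

      height≡ : ∀ x y → height $ (x , y) ≡ y ℚ.+ x ℚ.* σ
      height≡ x y = solve 3 (λ s x y → s :* x :+ con 1ℚ :* y :+ con 0ℚ := y :+ x :* s) ≡.refl σ x y
        where open +-*-Solver

      height-0 : ∀ q → height $ (ℕ→ℚ 0 , νf 0 q) ≡ 0ℚ
      height-0 q = ≡.trans (height≡ 0ℚ (νf 0 q)) (≡.cong₂ ℚ._+_ (νf₀ q) (ℚ.*-zeroˡ σ))

      0≤height : ∀ i q → 0ℚ ℚ.≤ height $ (ℕ→ℚ i , νf i q)
      0≤height zero    q = ℚ.≤-reflexive (≡.sym (height-0 q))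
      0≤height (suc i) q = ≡.subst (0ℚ ℚ.≤_)
        (≡.trans (≡.cong (ℚ._+ ℕ→ℚ (suc i) ℚ.* σ) (≡.sym (νf₁₊ i q (f#0⇒b#0 i q))))
          (≡.sym (height≡ (ℕ→ℚ (suc i)) (νf (suc i) q))))
        (proj₁ (proj₂ slope) (suc i) (f#0⇒b#0 i q))

      νfₙ : ∀ q → νf n q ≡ ℚ.- (ℕ→ℚ n ℚ.* σ)
      νfₙ q = ≡.trans (νf₁₊ n′ q bₙ#0) (inverseˡ-unique _ _ (proj₂ (proj₂ slope)))
        where open GroupProperties (CommutativeRing.+-group ℚ.+-*-commutativeRing) using (inverseˡ-unique)

      at-start : ∀ i q → ℕ→ℚ i ≡ 0ℚ → (ℕ→ℚ i , νf i q) ≡ start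
      at-start zero    q _  = ≡.cong (0ℚ ,_) (νf₀ q)
      at-start (suc i) q eq = ⊥-elim (ℚ.<-irrefl (≡.sym eq) (ℕ→ℚ-mono-< {0} {suc i} (s≤s z≤n)))

      at-end : ∀ i q → i ≡ n → (ℕ→ℚ i , νf i q) ≡ end
      at-end i q ≡.refl = ≡.cong (ℕ→ℚ n ,_) (νfₙ q)

      High : Set _
      High = ∃[ w ] CoefficientPoint νₚ F w × 0ℚ ℚ.< height $ w

      -- A bounded search. It can be carried out because each coefficient is the image of an element
      -- of ℚ̄ and therefore either zero or apart from zero.
      flat-below? : ∀ k → (∀ i → i ℕ.< k → ∀ q → height $ (ℕ→ℚ i , νf i q) ≡ 0ℚ) ⊎ High
      flat-below? zero    = inj₁ λ i ()
      flat-below? (suc k) = [ (λ flat → extend flat (f-zero? k)) , inj₂ ]′ (flat-below? k)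
        where
        Flat : ℕ → Set _
        Flat i = ∀ q → height $ (ℕ→ℚ i , νf i q) ≡ 0ℚ
        append : (∀ i → i ℕ.< k → Flat i) → Flat k → ∀ i → i ℕ.< suc k → Flat i
        append flat top i i<1+k = [ flat i , (λ i≡k → ≡.subst Flat (≡.sym i≡k) top) ]′ (ℕ.m<1+n⇒m<n∨m≡n i<1+k)
        extend : (∀ i → i ℕ.< k → Flat i) → f k ℚ̄ₚ.≈ ℚ̄ₚ.0# ⊎ f k ℚ̄ₚ.# ℚ̄ₚ.0# → (∀ i → i ℕ.< suc k → Flat i) ⊎ High
        extend flat (inj₁ fₖ≈0) = inj₁ (append flat λ q → ⊥-elim (ℚ̄ₚ.#-irrefl fₖ≈0 q))
        extend flat (inj₂ fₖ#0) = by-sign (ℚ.<-cmp 0ℚ h)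
          where
          h = height $ (ℕ→ℚ k , νf k fₖ#0)
          by-sign : Tri (0ℚ ℚ.< h) (0ℚ ≡ h) (h ℚ.< 0ℚ) → (∀ i → i ℕ.< suc k → Flat i) ⊎ High
          by-sign (tri< 0<h _ _) = inj₂ (_ , (k , fₖ#0 , ≡.refl , ≡.refl) , 0<h)
          by-sign (tri≈ _ 0≡h _) = inj₁ (append flat λ q →
            ≡.trans (≡.cong (λ y → height $ (ℕ→ℚ k , y)) (Valuation.ν-cong νₚ q fₖ#0 ℚ̄ₚ.refl)) (≡.sym 0≡h))
          by-sign (tri> _ _ h<0) = ⊥-elim (ℚ.<-irrefl ≡.refl (ℚ.≤-<-trans (0≤height k fₖ#0) h<0))

    new-isLineSegment : IsLineSegment (New S (B +ᵖ const (- 1#)))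
    new-isLineSegment = lowerBoundary-isLineSegment
      (0 , f₀#0 , ≡.refl , ≡.sym (νf₀ f₀#0))
      (n , f₁₊#0 n′ bₙ#0 , ≡.refl , ≡.sym (νfₙ (f₁₊#0 n′ bₙ#0)))
      (λ { _ (i , q , ≡.refl , ≡.refl) → 0≤height i q })
      (λ { _ (i , q , ≡.refl , ≡.refl) → 0≤ℕ→ℚ i })
      (λ { _ (i , q , ≡.refl , ≡.refl) → at-start i q })
      (λ { _ (i , q , ≡.refl , ≡.refl) → ℕ→ℚ-mono-≤ (index≤n i q) })
      (λ { _ (i , q , ≡.refl , ≡.refl) eq → at-end i q (ℕ→ℚ-injective eq) })
      ([ (λ flat → inj₁ λ { _ (i , q , ≡.refl , ≡.refl) → flat i (s≤s (index≤n i q)) q }) , inj₂ ]′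
        (flat-below? (suc n)))

theorem2 : ∀ {a b c : Level} (p : ℕ) → Prime p → (S : PAdicSetting p a b c) →
    let open PAdicSetting S
        open HeytingField ℚ̄
        open Polynomial ℚ̄
    in (B : Poly) (n : ℕ) → IsBelyi B → HasDegree B n → n < p → eval B 0# ≈ 0# →
       IsLineSegment (New S (B +ᵖ const (- 1#)))
theorem2 p _ S B zero    belyi degree n<p root =
  let i , nonzero = Polynomial.IsBelyi.nonconstant belyi
  in ⊥-elim (HeytingFieldProperties.#-irrefl (PAdicSetting.ℚ̄ S) (proj₂ degree (suc i) (s≤s z≤n)) nonzero)
theorem2 p _ S B (suc n) belyi degree n<p root = new-isLineSegment S B n belyi degree n<p root
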